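{- Let $p$ be an odd prime, $k,m,n\in\mathbb N$ and $b\in\{0,2,4,\ldots\}$. Then $$\left(1-\left(\frac p3\right)p^{k\varphi(p^m)+b}\right)U_{k\varphi(p^m)+b}\equiv\sum_{r=0}^{n-1}(-1)^{n-1-r}\binom{k-1-r}{n-1-r}\binom kr\left(1-\left(\frac p3\right)p^{r\varphi(p^m)+b}\right)U_{r\varphi(p^m)+b}\pmod{p^{mn}}.$$ In particular, for $n=1$ we have $$U_{k\varphi(p^m)+b}\equiv\left(1-\left(\frac p3\right)p^b\right)U_b\pmod{p^m}.$$
   Context: $\mathbb N$ is the set of positive integers; $[x]$ is the greatest integer not exceeding $x$. The sequence $\{U_n\}_{n\ge0}$ is defined by $U_0=1$ and $U_n=-2\sum_{k=1}^{[n/2]}\binom n{2k}U_{n-2k}$ for $n\ge1$. $\varphi$ is Euler's totient function. $\left(\frac p3\right)$ is the Legendre symbol: it equals $0$, $1$, $-1$ according as $p\equiv0,1,2\pmod3$. Binomial coefficients with possibly negative upper entry are $\binom xj=x(x-1)\cdots(x-j+1)/j!$ for integers $j\ge0$. -}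

module Defs where

open import Data.Fin.Base using (toℕ)
open import Data.Integer.Base hiding (suc; _%_)
open import Data.Integer.Divisibility using (_∣_)
open import Data.Integer.Properties using (+-0-commutativeMonoid)
open import Data.List.Base using (length; filter; applyUpTo)
open import Data.Nat.Base as ℕ using (ℕ; zero; suc; s≤s; ⌊_/2⌋; _∸_; _!; _%_)
open import Data.Nat.Combinatorics using (_C_)
open import Data.Nat.Coprimality using (coprime?)
open import Data.Nat.Induction using (<-Rec; <-rec; <-wellFounded)
open import Data.Nat.Properties using (m∸n≤m; _!≢0)
open import Induction.WellFounded using (module FixPoint)
open import Relation.Binary.PropositionalEquality.Core using (_≡_; refl; cong)

import Algebra.Properties.CommutativeMonoid.Sum as Sum
open Sum +-0-commutativeMonoid using (sum; sum-cong-≗)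

∑< : (n : ℕ) → (ℕ → ℤ) → ℤ
∑< n f = sum {n} (λ i → f (toℕ i))

infix 5 ∑<
syntax ∑< n (λ r → e) = ∑[ r < n ] e

infix 4 _≡_[mod_]

_≡_[mod_] : ℤ → ℤ → ℕ → Set
a ≡ b [mod M ] = + M ∣ a - b

φ : ℕ → ℕ
φ n = length (filter (λ a → coprime? a n) (applyUpTo suc n))

-- The Legendre symbol (p / 3).
⟨_/3⟩ : ℕ → ℤ
⟨ p /3⟩ with p % 3
... | 0 = 0ℤ
... | 1 = 1ℤ
... | _ = -1ℤ

falling : ℤ → ℕ → ℤ
falling x zero    = 1ℤ
falling x (suc j) = falling x j * (x - + j)

-- Binomial coefficient with integer upper entry.  The division is exact,
-- since j ! divides every product of j consecutive integers.
binom : ℤ → ℕ → ℤ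
binom x j = falling x j /ℕ j !
  where instance _ = j !≢0

-- U 0 = 1 and, for n ≥ 1, U n = -2 ∑_{k=1}^{⌊n/2⌋} C(n,2k) U (n - 2k), where
-- the sum is indexed by j = k - 1.  The recursion is well-founded on _<_;
-- U-rec below is the resulting equation.
private
  decreases : ∀ n j → suc n ∸ 2 ℕ.* suc j ℕ.< suc n
  decreases n j = s≤s (m∸n≤m n (j ℕ.+ 1 ℕ.* suc j))

  U-step : ∀ n → <-Rec (λ _ → ℤ) n → ℤ
  U-step zero    _  = 1ℤ
  U-step (suc n) U′ = - + 2 * (∑[ j < ⌊ suc n /2⌋ ]
    + (suc n C (2 ℕ.* suc j)) * U′ (decreases n j))

U : ℕ → ℤ
U = <-rec (λ _ → ℤ) U-step

U-zero : U 0 ≡ 1ℤ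
U-zero = refl

U-rec : ∀ n .{{_ : ℕ.NonZero n}} →
        U n ≡ - + 2 * (∑[ j < ⌊ n /2⌋ ]
          + (n C (2 ℕ.* suc j)) * U (n ∸ 2 ℕ.* suc j))
U-rec (suc n) = FixPoint.unfold-wfRec <-wellFounded (λ _ → ℤ) U-step U-ext {suc n}
  where
  U-ext : ∀ n {V W : <-Rec (λ _ → ℤ) n} →
          (∀ {y} y<n → V {y} y<n ≡ W y<n) → U-step n V ≡ U-step n W
  U-ext zero    _  = refl
  U-ext (suc n) eq = cong (- + 2 *_)
    (sum-cong-≗ {⌊ suc n /2⌋} λ i → cong (+ (suc n C (2 ℕ.* suc (toℕ i))) *_) (eq (decreases n (toℕ i))))

{-# OPTIONS --safe #-}
module Submission where

-- Let c(j) = (-1)^(j-1) (j/3), the coefficients of x/(1 - x + x²), so that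
-- c(j+1) - c(j) + c(j-1) = 0 for j ≥ 1 and c(pj) = (p/3) c(j) for odd p.
-- Summation by parts shows that the power sums T_n = ∑_{j<N} c(j) j^n satisfy
-- the recursion defining U_n up to N^n when N = 3K with K odd, whence
-- 2 U_n ≡ T_n (mod N).  Discarding the multiples of p turns this into
-- 2 (1 - (p/3) p^e) U_e ≡ ∑_{p∤j} c(j) j^e modulo arbitrarily high powers of p.
-- With x = j^φ(p^m) ≡ 1 (mod p^m), the congruence then follows term by term from
-- the polynomial divisibility (x - 1)^n ∣ x^k - ∑_{r<n} w_r x^r, in which w_r are
-- the weights of the theorem: the sum is the Taylor polynomial of x^k at 1.

open import Defs
import Algebra.Properties.CommutativeMonoid.Sum as Sum
import Algebra.Properties.CommutativeSemiring.Binomial as Binomial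
import Algebra.Properties.Semiring.Exp as SemiringExp
import Algebra.Properties.Semiring.Mult as SemiringMult
import Algebra.Properties.Semiring.Sum as SemiringSum
open import Data.Fin.Base using (toℕ)
open import Data.Fin.Properties using (toℕ<n)
open import Data.Integer.Base using (ℤ; +_; -[1+_]; 0ℤ; 1ℤ; -1ℤ; _+_; _*_; _-_; -_; _^_; _/ℕ_; ∣_∣)
open import Data.Integer.Divisibility.Signed as ℤ∣ using () renaming (_∣_ to _∣ℤ_)
import Data.Integer.Properties as ℤ
open import Data.Integer.Tactic.RingSolver using (solve-∀)
open import Data.List.Base using (length; filter; applyUpTo; _++_; _∷ʳ_; []; _∷_)
open import Data.List.Properties using (filter-++; filter-all; filter-reject; length-++; length-applyUpTo; applyUpTo-∷ʳ)
open import Data.List.Relation.Unary.All.Properties using (applyUpTo⁺₁)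
open import Data.Nat.Base as ℕ using (ℕ; zero; suc; NonZero; _∸_; _!; _<_; _≤_; s≤s; z≤n; ⌊_/2⌋)
open import Data.Nat.Combinatorics using
  (_C_; nCk≡n!/k![n-k]!; k![n∸k]!∣n!; k>n⇒nCk≡0; nCn≡1; nC1≡n; nCk≡nC[n∸k]; nCk+nC[k+1]≡[n+1]C[k+1])
open import Data.Nat.Coprimality using (Coprime; coprime?; coprime-divisor)
open import Data.Nat.Divisibility using
  (_∣_; _∤_; divides; ∣-refl; ∣-trans; ∣1⇒≡1; ∣m⇒∣m*n; ∣m∣n⇒∣m+n; ∣m+n∣m⇒∣n; >⇒∤; m∣m*n; n∣m*n)
open import Data.Nat.DivMod using (m/n*n≡m; m*n/n≡m; m*n%n≡0; m≡m%n+[m/n]*n; m%n<n; [m+kn]%n≡m%n)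
open import Data.Nat.Induction using (<-rec)
open import Data.Nat.Primality using (Prime; euclidsLemma; prime⇒irreducible; ¬prime[0]; ¬prime[1])
import Data.Nat.Properties as ℕ
open import Data.Nat.Tactic.RingSolver using () renaming (solve-∀ to ℕ-solve-∀)
open import Data.Product.Base using (_,_; _×_; ∃)
open import Data.Sum.Base using (inj₁; inj₂)
open import Function.Base using (_∘_)
open import Relation.Binary.PropositionalEquality using
  (_≡_; refl; sym; trans; cong; cong₂; subst; subst₂; module ≡-Reasoning)
open import Relation.Nullary.Negation.Core using (¬_; contradiction)

open ≡-Reasoning

-- Finite sums

∑<-cong : ∀ n {f g : ℕ → ℤ} → (∀ i → i < n → f i ≡ g i) → ∑< n f ≡ ∑< n g
∑<-cong n f≗g = Sum.sum-cong-≗ ℤ.+-0-commutativeMonoid {n} (λ i → f≗g (toℕ i) (toℕ<n i))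

∑<-distrib-+ : ∀ n (f g : ℕ → ℤ) → ∑[ i < n ] (f i + g i) ≡ (∑[ i < n ] f i) + (∑[ i < n ] g i)
∑<-distrib-+ n f g = Sum.∑-distrib-+ ℤ.+-0-commutativeMonoid {n} (f ∘ toℕ) (g ∘ toℕ)

*-distribˡ-∑< : ∀ n x (f : ℕ → ℤ) → x * ∑< n f ≡ ∑[ i < n ] x * f i
*-distribˡ-∑< n x f = SemiringSum.*-distribˡ-sum ℤ.+-*-semiring {n} x (f ∘ toℕ)

∑<-comm : ∀ m n (f : ℕ → ℕ → ℤ) → (∑[ i < m ] ∑[ j < n ] f i j) ≡ (∑[ j < n ] ∑[ i < m ] f i j)
∑<-comm m n f = Sum.∑-comm ℤ.+-0-commutativeMonoid {m} {n} (λ i j → f (toℕ i) (toℕ j))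

∑<-++ : ∀ m n (f : ℕ → ℤ) → ∑< (m ℕ.+ n) f ≡ ∑< m f + (∑[ i < n ] f (m ℕ.+ i))
∑<-++ zero    n f = sym (ℤ.+-identityˡ _)
∑<-++ (suc m) n f = trans (cong (_+_ (f 0)) (∑<-++ m n (f ∘ suc))) (sym (ℤ.+-assoc (f 0) _ _))

∑<-last : ∀ n (f : ℕ → ℤ) → ∑< (suc n) f ≡ ∑< n f + f n
∑<-last zero    f = trans (ℤ.+-identityʳ (f 0)) (sym (ℤ.+-identityˡ (f 0)))
∑<-last (suc n) f = trans (cong (_+_ (f 0)) (∑<-last n (f ∘ suc))) (sym (ℤ.+-assoc (f 0) _ _))

∑<-∣ : ∀ n {d} {f : ℕ → ℤ} → (∀ i → i < n → d ∣ℤ f i) → d ∣ℤ ∑< n f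
∑<-∣ zero    d∣f = ℤ∣.divides 0ℤ refl
∑<-∣ (suc n) d∣f = ℤ∣.∣m∣n⇒∣m+n (d∣f 0 (s≤s z≤n)) (∑<-∣ n (λ i i<n → d∣f (suc i) (s≤s i<n)))

∑<-blocks : ∀ n l (f : ℕ → ℤ) → ∑< (n ℕ.* l) f ≡ (∑[ i < n ] ∑[ t < l ] f (i ℕ.* l ℕ.+ t))
∑<-blocks zero    l f = refl
∑<-blocks (suc n) l f = begin
  ∑< (l ℕ.+ n ℕ.* l) f
    ≡⟨ ∑<-++ l (n ℕ.* l) f ⟩
  ∑< l f + (∑[ i < n ℕ.* l ] f (l ℕ.+ i))
    ≡⟨ cong (_+_ (∑< l f)) (∑<-blocks n l (f ∘ (l ℕ.+_))) ⟩
  ∑< l f + (∑[ i < n ] ∑[ t < l ] f (l ℕ.+ (i ℕ.* l ℕ.+ t)))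
    ≡⟨ cong (_+_ (∑< l f)) (∑<-cong n λ i _ → ∑<-cong l λ t _ → cong f (sym (ℕ.+-assoc l (i ℕ.* l) t))) ⟩
  ∑< l f + (∑[ i < n ] ∑[ t < l ] f (suc i ℕ.* l ℕ.+ t)) ∎

-- The weights do not depend on i, so congruences expressing each f i through the g r i may be added
-- up over i. Used twice in succession, for the two summation indices of `S`.
∑<-∣-interchange : ∀ n l {d} (w f : ℕ → ℤ) (g : ℕ → ℕ → ℤ) →
  (∀ i → i < n → d ∣ℤ f i - (∑[ r < l ] w r * g r i)) →
  d ∣ℤ (∑< n f) - (∑[ r < l ] w r * ∑< n (g r))
∑<-∣-interchange n l w f g d∣ = subst (_ ∣ℤ_) eq (∑<-∣ n d∣)
  where
  eq : (∑[ i < n ] (f i - (∑[ r < l ] w r * g r i))) ≡ (∑< n f) - (∑[ r < l ] w r * ∑< n (g r))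
  h : ℕ → ℤ
  h i = ∑[ r < l ] w r * g r i
  eq = begin
    (∑[ i < n ] (f i - h i))
      ≡⟨ ∑<-distrib-+ n f (λ i → - h i) ⟩
    ∑< n f + (∑[ i < n ] - h i)
      ≡⟨ cong (_+_ (∑< n f)) (∑<-cong n {λ i → - h i} {λ i → -1ℤ * h i} λ i _ → sym (ℤ.-1*i≡-i (h i))) ⟩
    ∑< n f + (∑[ i < n ] -1ℤ * h i)
      ≡⟨ cong (_+_ (∑< n f)) (trans (sym (*-distribˡ-∑< n -1ℤ h)) (ℤ.-1*i≡-i (∑< n h))) ⟩
    ∑< n f - ∑< n h
      ≡⟨ cong (λ z → ∑< n f - z) (∑<-comm n l (λ i r → w r * g r i)) ⟩
    ∑< n f - (∑[ r < l ] ∑[ i < n ] w r * g r i)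
      ≡⟨ cong (λ z → ∑< n f - z) (∑<-cong l λ r _ → *-distribˡ-∑< n (w r) (g r)) ⟨
    ∑< n f - (∑[ r < l ] w r * ∑< n (g r)) ∎

-- Binomial coefficients

nC0≡1 : ∀ n → n C 0 ≡ 1
nC0≡1 n = trans (nCk≡nC[n∸k] {0} {n} z≤n) (nCn≡1 n)

private
  module B = Binomial ℤ.+-*-commutativeSemiring
  module Exp = SemiringExp ℤ.+-*-semiring
  module Mult = SemiringMult ℤ.+-*-semiring

  -- The library's binomial theorem speaks of powers and multiples in an arbitrary semiring; these
  -- two lemmas identify them with the operations of ℤ.
  ^-agree : ∀ x n → x Exp.^ n ≡ x ^ n
  ^-agree x zero    = refl
  ^-agree x (suc n) = cong (x *_) (^-agree x n)

  ×-agree : ∀ n x → n Mult.× x ≡ + n * x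
  ×-agree zero    x = sym (ℤ.*-zeroˡ x)
  ×-agree (suc n) x = trans (cong (_+_ x) (×-agree n x)) (sym (ℤ.suc-* (+ n) x))

binomial-theorem : ∀ n x y → (x + y) ^ n ≡ ∑[ i < suc n ] + (n C i) * (x ^ i * y ^ (n ∸ i))
binomial-theorem n x y = begin
  (x + y) ^ n               ≡⟨ ^-agree (x + y) n ⟨
  (x + y) Exp.^ n           ≡⟨ B.theorem n x y ⟩
  B.binomialExpansion x y n ≡⟨ Sum.sum-cong-≗ ℤ.+-0-commutativeMonoid {suc n} (λ i →
    trans (×-agree (n C toℕ i) _)
      (cong (+ (n C toℕ i) *_) (cong₂ _*_ (^-agree x (toℕ i)) (^-agree y (n ∸ toℕ i))))) ⟩
  (∑[ i < suc n ] + (n C i) * (x ^ i * y ^ (n ∸ i))) ∎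

-- Truncated binomial expansions

taylor : ℕ → ℕ → ℤ → ℤ
taylor n k y = ∑[ s < n ] + (k C s) * y ^ s

-- Pascal's rule in each term. It is the truncation of (1 + y)^(k+1) = (1 + y)^k + y (1 + y)^k; the
-- factor y raises degrees by one, whence the shorter second polynomial.
taylor-suc : ∀ n k y → taylor (suc n) (suc k) y ≡ taylor (suc n) k y + y * taylor n k y
taylor-suc n k y = begin
  + (suc k C 0) * 1ℤ + (∑[ s < n ] + (suc k C suc s) * (y * y ^ s))
    ≡⟨ cong₂ (λ u v → + u * 1ℤ + v) (trans (nC0≡1 (suc k)) (sym (nC0≡1 k))) (∑<-cong n λ s _ → step s) ⟩
  + (k C 0) * 1ℤ + (∑[ s < n ] (f s + y * g s))
    ≡⟨ cong (_+_ (+ (k C 0) * 1ℤ)) (∑<-distrib-+ n f (λ s → y * g s)) ⟩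
  + (k C 0) * 1ℤ + (∑< n f + (∑[ s < n ] y * g s))
    ≡⟨ ℤ.+-assoc (+ (k C 0) * 1ℤ) (∑< n f) _ ⟨
  taylor (suc n) k y + (∑[ s < n ] y * g s)
    ≡⟨ cong (_+_ (taylor (suc n) k y)) (*-distribˡ-∑< n y g) ⟨
  taylor (suc n) k y + y * taylor n k y ∎
  where
  f g : ℕ → ℤ
  f s = + (k C suc s) * (y * y ^ s)
  g s = + (k C s) * y ^ s
  ring : ∀ a b y z → (a + b) * (y * z) ≡ b * (y * z) + y * (a * z)
  ring = solve-∀
  step : ∀ s → + (suc k C suc s) * (y * y ^ s) ≡ f s + y * g s
  step s = begin
    + (suc k C suc s) * (y * y ^ s)
      ≡⟨ cong (λ c → + c * (y * y ^ s)) (nCk+nC[k+1]≡[n+1]C[k+1] k s) ⟨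
    + (k C s ℕ.+ k C suc s) * (y * y ^ s)
      ≡⟨ cong (_* (y * y ^ s)) (ℤ.pos-+ (k C s) (k C suc s)) ⟩
    (+ (k C s) + + (k C suc s)) * (y * y ^ s)
      ≡⟨ ring (+ (k C s)) (+ (k C suc s)) y (y ^ s) ⟩
    f s + y * g s ∎

-- Induction on n and k: by `taylor-suc` the remainder for (n+1, k+1) is the one for (n+1, k) plus y
-- times the one for (n, k).
^-∣-taylor-remainder : ∀ n k y → y ^ n ∣ℤ (1ℤ + y) ^ k - taylor n k y
^-∣-taylor-remainder zero    k       y = ℤ∣.divides ((1ℤ + y) ^ k - 0ℤ) (sym (ℤ.*-identityʳ ((1ℤ + y) ^ k - 0ℤ)))
^-∣-taylor-remainder (suc n) zero    y = ℤ∣.divides 0ℤ (cong (λ z → 1ℤ - (1ℤ + z)) (zeros n))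
  where
  zeros : ∀ n → (∑[ s < n ] + (0 C suc s) * y ^ suc s) ≡ 0ℤ
  zeros n = trans
    (∑<-cong n {g = λ _ → 0ℤ} λ s _ → cong (λ c → + c * y ^ suc s) (k>n⇒nCk≡0 {0} {suc s} (s≤s z≤n)))
    (sym (*-distribˡ-∑< n 0ℤ (y ^_)))
^-∣-taylor-remainder (suc n) (suc k) y = subst (y ^ suc n ∣ℤ_)
  (trans (ring ((1ℤ + y) ^ k) y (taylor (suc n) k y) (taylor n k y))
    (cong (λ z → (1ℤ + y) ^ suc k - z) (sym (taylor-suc n k y))))
  (ℤ∣.∣m∣n⇒∣m+n (^-∣-taylor-remainder (suc n) k y) (ℤ∣.*-monoʳ-∣ y (^-∣-taylor-remainder n k y)))
  where
  ring : ∀ a y s t → (a - s) + y * (a - t) ≡ (1ℤ + y) * a - (s + y * t)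
  ring = solve-∀

[m+n]Cm*m!*n!≡[m+n]! : ∀ m n → ((m ℕ.+ n) C m) ℕ.* (m ! ℕ.* n !) ≡ (m ℕ.+ n) !
[m+n]Cm*m!*n!≡[m+n]! m n = subst (λ l → ((m ℕ.+ n) C m) ℕ.* (m ! ℕ.* l !) ≡ (m ℕ.+ n) !) (ℕ.m+n∸m≡n m n) (begin
  ((m ℕ.+ n) C m) ℕ.* (m ! ℕ.* (m ℕ.+ n ∸ m) !)
    ≡⟨ cong (ℕ._* (m ! ℕ.* (m ℕ.+ n ∸ m) !)) (nCk≡n!/k![n-k]! (ℕ.m≤m+n m n)) ⟩
  (m ℕ.+ n) ! ℕ./ (m ! ℕ.* (m ℕ.+ n ∸ m) !) ℕ.* (m ! ℕ.* (m ℕ.+ n ∸ m) !)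
    ≡⟨ m/n*n≡m (k![n∸k]!∣n! (ℕ.m≤m+n m n)) ⟩
  (m ℕ.+ n) ! ∎)
  where instance _ = m ℕ.!* (m ℕ.+ n ∸ m) !≢0

-- Trinomial revision. For n = l + d both sides times m! l! d! equal (m + l + d)!; for n < l both
-- sides vanish.
[m+n]Cm*nCl≡[m+n]C[m+l]*[m+l]Cm : ∀ m n l →
  ((m ℕ.+ n) C m) ℕ.* (n C l) ≡ ((m ℕ.+ n) C (m ℕ.+ l)) ℕ.* ((m ℕ.+ l) C m)
[m+n]Cm*nCl≡[m+n]C[m+l]*[m+l]Cm m n l with ℕ.≤-<-connex l n
... | inj₂ n<l = trans
  (trans (cong (((m ℕ.+ n) C m) ℕ.*_) (k>n⇒nCk≡0 n<l)) (ℕ.*-zeroʳ ((m ℕ.+ n) C m)))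
  (sym (cong (ℕ._* ((m ℕ.+ l) C m)) (k>n⇒nCk≡0 (ℕ.+-monoʳ-< m n<l))))
... | inj₁ l≤n with ℕ.m≤n⇒∃[o]m+o≡n l≤n
... | d , refl = ℕ.*-cancelʳ-≡ _ _ (m ! ℕ.* (l ! ℕ.* d !)) (begin
  x ℕ.* y ℕ.* (m ! ℕ.* (l ! ℕ.* d !))
    ≡⟨ ring₁ x y (m !) (l ! ℕ.* d !) ⟩
  x ℕ.* (m ! ℕ.* (y ℕ.* (l ! ℕ.* d !)))
    ≡⟨ cong (λ z → x ℕ.* (m ! ℕ.* z)) ([m+n]Cm*m!*n!≡[m+n]! l d) ⟩
  x ℕ.* (m ! ℕ.* (l ℕ.+ d) !)
    ≡⟨ [m+n]Cm*m!*n!≡[m+n]! m (l ℕ.+ d) ⟩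
  (m ℕ.+ (l ℕ.+ d)) !
    ≡⟨ cong _! (ℕ.+-assoc m l d) ⟨
  (m ℕ.+ l ℕ.+ d) !
    ≡⟨ [m+n]Cm*m!*n!≡[m+n]! (m ℕ.+ l) d ⟨
  ((m ℕ.+ l ℕ.+ d) C (m ℕ.+ l)) ℕ.* ((m ℕ.+ l) ! ℕ.* d !)
    ≡⟨ cong₂ (λ t z → (t C (m ℕ.+ l)) ℕ.* (z ℕ.* d !)) (ℕ.+-assoc m l d) (sym ([m+n]Cm*m!*n!≡[m+n]! m l)) ⟩
  u ℕ.* (v ℕ.* (m ! ℕ.* l !) ℕ.* d !)
    ≡⟨ ring₂ u v (m !) (l !) (d !) ⟩
  u ℕ.* v ℕ.* (m ! ℕ.* (l ! ℕ.* d !)) ∎)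
  where
  instance
    _ = m ℕ.!≢0
    _ = l ℕ.!* d !≢0
    _ = ℕ.m*n≢0 (m !) (l ! ℕ.* d !)
  x = (m ℕ.+ (l ℕ.+ d)) C m
  y = (l ℕ.+ d) C l
  u = (m ℕ.+ (l ℕ.+ d)) C (m ℕ.+ l)
  v = (m ℕ.+ l) C m
  ring₁ : ∀ x y a b → x ℕ.* y ℕ.* (a ℕ.* b) ≡ x ℕ.* (a ℕ.* (y ℕ.* b))
  ring₁ = ℕ-solve-∀
  ring₂ : ∀ u v a b c → u ℕ.* (v ℕ.* (a ℕ.* b) ℕ.* c) ≡ u ℕ.* v ℕ.* (a ℕ.* (b ℕ.* c))
  ring₂ = ℕ-solve-∀

-- Binomial coefficients with upper entry at least -1

falling-pascal : ∀ x j → falling (1ℤ + x) (suc j) ≡ falling x (suc j) + + suc j * falling x j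
falling-pascal x zero    = ring x
  where
  ring : ∀ x → 1ℤ * (1ℤ + x - 0ℤ) ≡ 1ℤ * (x - 0ℤ) + 1ℤ * 1ℤ
  ring = solve-∀
falling-pascal x (suc j) = begin
  falling (1ℤ + x) (suc j) * (1ℤ + x - + suc j)
    ≡⟨ cong (_* (1ℤ + x - + suc j)) (falling-pascal x j) ⟩
  (falling x j * (x - + j) + (1ℤ + + j) * falling x j) * (1ℤ + x - (1ℤ + + j))
    ≡⟨ ring (falling x j) x (+ j) ⟩
  falling x j * (x - + j) * (x - (1ℤ + + j)) + (1ℤ + (1ℤ + + j)) * (falling x j * (x - + j)) ∎
  where
  ring : ∀ f x j → (f * (x - j) + (1ℤ + j) * f) * (1ℤ + x - (1ℤ + j))
                 ≡ f * (x - j) * (x - (1ℤ + j)) + (1ℤ + (1ℤ + j)) * (f * (x - j))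
  ring = solve-∀

-- The binomial coefficient with upper entry a - 1.
binom-pred : ℕ → ℕ → ℤ
binom-pred zero    j = -1ℤ ^ j
binom-pred (suc a) j = + (a C j)

binom-pred-zero : ∀ a → binom-pred a 0 ≡ 1ℤ
binom-pred-zero zero    = refl
binom-pred-zero (suc a) = cong +_ (nC0≡1 a)

-- For a = 0 this reads 0 = (-1)^(j+1) + (-1)^j: the values (-1)^j at upper entry -1 continue
-- Pascal's rule one row above the triangle.
binom-pred-pascal : ∀ a j → + (a C suc j) ≡ binom-pred a (suc j) + binom-pred a j
binom-pred-pascal zero    j = trans (cong +_ (k>n⇒nCk≡0 {0} {suc j} (s≤s z≤n))) (ring (-1ℤ ^ j))
  where
  ring : ∀ x → 0ℤ ≡ -1ℤ * x + x
  ring = solve-∀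
binom-pred-pascal (suc a) j = begin
  + (suc a C suc j)         ≡⟨ cong +_ (nCk+nC[k+1]≡[n+1]C[k+1] a j) ⟨
  + (a C j ℕ.+ a C suc j)   ≡⟨ cong +_ (ℕ.+-comm (a C j) (a C suc j)) ⟩
  + (a C suc j ℕ.+ a C j)   ≡⟨ ℤ.pos-+ (a C suc j) (a C j) ⟩
  + (a C suc j) + + (a C j) ∎

-- At upper entry -1 the product (-1)(-2)...(-j) is (-1)^j j!. From there on, Pascal's rules for
-- `falling` and for `binom-pred` run in parallel.
falling≡binom-pred*j! : ∀ a j → falling (-1ℤ + + a) j ≡ binom-pred a j * + (j !)
falling≡binom-pred*j! a zero    = sym (trans (ℤ.*-identityʳ _) (binom-pred-zero a))
falling≡binom-pred*j! zero (suc j) = begin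
  falling -1ℤ j * (-1ℤ - + j)                ≡⟨ cong (_* (-1ℤ - + j)) (falling≡binom-pred*j! zero j) ⟩
  -1ℤ ^ j * + (j !) * (-1ℤ - + j)            ≡⟨ ring (-1ℤ ^ j) (+ (j !)) (+ j) ⟩
  -1ℤ * -1ℤ ^ j * ((1ℤ + + j) * + (j !))     ≡⟨ cong (-1ℤ * -1ℤ ^ j *_) (ℤ.pos-* (suc j) (j !)) ⟨
  -1ℤ * -1ℤ ^ j * + (suc j !)                ∎
  where
  ring : ∀ x f j → x * f * (-1ℤ - j) ≡ -1ℤ * x * ((1ℤ + j) * f)
  ring = solve-∀
falling≡binom-pred*j! (suc a) (suc j) = begin
  falling (+ a) (suc j)
    ≡⟨ cong (λ x → falling x (suc j)) (shift (+ a)) ⟩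
  falling (1ℤ + (-1ℤ + + a)) (suc j)
    ≡⟨ falling-pascal (-1ℤ + + a) j ⟩
  falling (-1ℤ + + a) (suc j) + + suc j * falling (-1ℤ + + a) j
    ≡⟨ cong₂ (λ u v → u + + suc j * v) (falling≡binom-pred*j! a (suc j)) (falling≡binom-pred*j! a j) ⟩
  binom-pred a (suc j) * + (suc j ℕ.* j !) + + suc j * (binom-pred a j * + (j !))
    ≡⟨ cong (λ u → binom-pred a (suc j) * u + + suc j * (binom-pred a j * + (j !))) (ℤ.pos-* (suc j) (j !)) ⟩
  binom-pred a (suc j) * (+ suc j * + (j !)) + + suc j * (binom-pred a j * + (j !))
    ≡⟨ ring (binom-pred a (suc j)) (binom-pred a j) (+ suc j) (+ (j !)) ⟩
  (binom-pred a (suc j) + binom-pred a j) * (+ suc j * + (j !))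
    ≡⟨ cong₂ _*_ (binom-pred-pascal a j) (ℤ.pos-* (suc j) (j !)) ⟨
  + (a C suc j) * + (suc j !) ∎
  where
  shift : ∀ x → x ≡ 1ℤ + (-1ℤ + x)
  shift = solve-∀
  ring : ∀ u v s f → u * (s * f) + s * (v * f) ≡ (u + v) * (s * f)
  ring = solve-∀

z*d/ℕd≡z : ∀ z d .{{_ : NonZero d}} → (z * + d) /ℕ d ≡ z
z*d/ℕd≡z (+ n)    d         = trans (cong (_/ℕ d) (sym (ℤ.pos-* n d))) (cong +_ (m*n/n≡m n d))
-- On a negative numerator `_/ℕ_` branches on the remainder; exactness leaves only the zero branch.
z*d/ℕd≡z -[1+ n ] d@(suc _) with suc n ℕ.* d ℕ.% d in eq
... | zero  = cong (λ q → - + q) (m*n/n≡m (suc n) d)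
... | suc r with () ← trans (sym eq) (m*n%n≡0 (suc n) d)

binom≡binom-pred : ∀ a j → binom (-1ℤ + + a) j ≡ binom-pred a j
binom≡binom-pred a j = trans (cong (_/ℕ j !) (falling≡binom-pred*j! a j)) (z*d/ℕd≡z (binom-pred a j) (j !))
  where instance _ = j ℕ.!≢0

-- The weights of the theorem

weight : ℕ → ℕ → ℕ → ℤ
weight n k r = -1ℤ ^ (n ∸ 1 ∸ r) * binom (+ k - 1ℤ - + r) (n ∸ 1 ∸ r) * + (k C r)

-- For r > k the upper entry k - 1 - r lies below -1, out of reach of `binom-pred`, but the factor
-- C(k,r) vanishes.
weight-> : ∀ n {k r} → k < r → weight n k r ≡ 0ℤ
weight-> n {k} {r} k<r = trans (cong (λ c → a * + c) (k>n⇒nCk≡0 k<r)) (ℤ.*-zeroʳ a)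
  where a = -1ℤ ^ (n ∸ 1 ∸ r) * binom (+ k - 1ℤ - + r) (n ∸ 1 ∸ r)

-- The substitution n = r + d + 1, k = r + a removes the truncated subtractions and turns the upper
-- entry k - 1 - r into a - 1.
weight-+ : ∀ r d a → weight (suc (r ℕ.+ d)) (r ℕ.+ a) r ≡ -1ℤ ^ d * binom-pred a d * + ((r ℕ.+ a) C r)
weight-+ r d a = begin
  -1ℤ ^ (r ℕ.+ d ∸ r) * binom (+ (r ℕ.+ a) - 1ℤ - + r) (r ℕ.+ d ∸ r) * + ((r ℕ.+ a) C r)
    ≡⟨ cong₂ (λ e x → -1ℤ ^ e * binom x e * + ((r ℕ.+ a) C r)) (ℕ.m+n∸m≡n r d)
        (trans (cong (λ x → x - 1ℤ - + r) (ℤ.pos-+ r a)) (ring (+ r) (+ a))) ⟩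
  -1ℤ ^ d * binom (-1ℤ + + a) d * + ((r ℕ.+ a) C r)
    ≡⟨ cong (λ x → -1ℤ ^ d * x * + ((r ℕ.+ a) C r)) (binom≡binom-pred a d) ⟩
  -1ℤ ^ d * binom-pred a d * + ((r ℕ.+ a) C r) ∎
  where
  ring : ∀ r a → r + a - 1ℤ - r ≡ -1ℤ + a
  ring = solve-∀

weight-last : ∀ n k → weight (suc n) k n ≡ + (k C n)
weight-last n k with ℕ.≤-<-connex n k
... | inj₂ k<n = trans (weight-> (suc n) k<n) (cong +_ (sym (k>n⇒nCk≡0 k<n)))
... | inj₁ n≤k with ℕ.m≤n⇒∃[o]m+o≡n n≤k
... | a , refl = begin
  weight (suc n) (n ℕ.+ a) n
    ≡⟨ cong (λ l → weight (suc l) (n ℕ.+ a) n) (ℕ.+-identityʳ n) ⟨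
  weight (suc (n ℕ.+ 0)) (n ℕ.+ a) n
    ≡⟨ weight-+ n 0 a ⟩
  1ℤ * binom-pred a 0 * + ((n ℕ.+ a) C n)
    ≡⟨ cong (λ z → 1ℤ * z * + ((n ℕ.+ a) C n)) (binom-pred-zero a) ⟩
  1ℤ * + ((n ℕ.+ a) C n)
    ≡⟨ ℤ.*-identityˡ _ ⟩
  + ((n ℕ.+ a) C n) ∎

-- Raising the degree adds C(k,n) (x - 1)^n to the Taylor polynomial, and the last summand is the
-- coefficient of x^r in it. With d = n - 1 - r and a = k - r, the identity follows from C(a-1,d+1)
-- = C(a,d+1) - C(a-1,d) and the trinomial revision C(k,r) C(k-r,n-r) = C(k,n) C(n,r).
weight-suc : ∀ n k r → r < n → weight (suc n) k r ≡ weight n k r + + (k C n) * (+ (n C r) * -1ℤ ^ (n ∸ r))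
weight-suc n k r r<n with ℕ.≤-<-connex r k
... | inj₂ k<r = trans (weight-> (suc n) k<r) (sym (cong₂ _+_ (weight-> n k<r)
  (cong (λ c → + c * (+ (n C r) * -1ℤ ^ (n ∸ r))) (k>n⇒nCk≡0 (ℕ.<-trans k<r r<n)))))
... | inj₁ r≤k with ℕ.m≤n⇒∃[o]m+o≡n r≤k | ℕ.m≤n⇒∃[o]m+o≡n r<n
... | a , refl | d , refl = begin
  weight (suc (suc (r ℕ.+ d))) (r ℕ.+ a) r
    ≡⟨ cong (λ l → weight (suc l) (r ℕ.+ a) r) r+sd ⟨
  weight (suc (r ℕ.+ suc d)) (r ℕ.+ a) r
    ≡⟨ weight-+ r (suc d) a ⟩
  -1ℤ * s * binom-pred a (suc d) * c
    ≡⟨ ring₁ s (binom-pred a (suc d)) (binom-pred a d) c ⟩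
  s * binom-pred a d * c + (c * (binom-pred a (suc d) + binom-pred a d)) * (-1ℤ * s)
    ≡⟨ cong₂ (λ u v → u + (c * v) * (-1ℤ * s)) (sym (weight-+ r d a)) (sym (binom-pred-pascal a d)) ⟩
  weight n (r ℕ.+ a) r + (c * + (a C suc d)) * (-1ℤ * s)
    ≡⟨ cong (λ u → weight n (r ℕ.+ a) r + u * (-1ℤ * s)) revision ⟩
  weight n (r ℕ.+ a) r + (+ ((r ℕ.+ a) C n) * + (n C r)) * (-1ℤ * s)
    ≡⟨ cong (_+_ (weight n (r ℕ.+ a) r)) (ℤ.*-assoc (+ ((r ℕ.+ a) C n)) _ _) ⟩
  weight n (r ℕ.+ a) r + + ((r ℕ.+ a) C n) * (+ (n C r) * (-1ℤ * s))
    ≡⟨ cong (λ e → weight n (r ℕ.+ a) r + + ((r ℕ.+ a) C n) * (+ (n C r) * -1ℤ ^ e)) n∸r ⟨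
  weight n (r ℕ.+ a) r + + ((r ℕ.+ a) C n) * (+ (n C r) * -1ℤ ^ (n ∸ r)) ∎
  where
  s = -1ℤ ^ d
  c = + ((r ℕ.+ a) C r)
  r+sd : r ℕ.+ suc d ≡ n
  r+sd = ℕ.+-suc r d
  n∸r : n ∸ r ≡ suc d
  n∸r = trans (cong (_∸ r) (sym r+sd)) (ℕ.m+n∸m≡n r (suc d))
  revision : c * + (a C suc d) ≡ + ((r ℕ.+ a) C n) * + (n C r)
  revision = begin
    c * + (a C suc d)
      ≡⟨ ℤ.pos-* ((r ℕ.+ a) C r) (a C suc d) ⟨
    + (((r ℕ.+ a) C r) ℕ.* (a C suc d))
      ≡⟨ cong +_ ([m+n]Cm*nCl≡[m+n]C[m+l]*[m+l]Cm r a (suc d)) ⟩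
    + (((r ℕ.+ a) C (r ℕ.+ suc d)) ℕ.* ((r ℕ.+ suc d) C r))
      ≡⟨ cong (λ l → + (((r ℕ.+ a) C l) ℕ.* (l C r))) r+sd ⟩
    + (((r ℕ.+ a) C n) ℕ.* (n C r))
      ≡⟨ ℤ.pos-* ((r ℕ.+ a) C n) (n C r) ⟩
    + ((r ℕ.+ a) C n) * + (n C r) ∎
  ring₁ : ∀ s u v c → -1ℤ * s * u * c ≡ s * v * c + (c * (u + v)) * (-1ℤ * s)
  ring₁ = solve-∀

-- Induction on n: the new term C(k,n) (x - 1)^n is expanded by the binomial theorem. Its lower
-- coefficients are the increments in `weight-suc`, its leading one is given by `weight-last`.
taylor≡weights : ∀ n k x → taylor n k (x - 1ℤ) ≡ ∑[ r < n ] weight n k r * x ^ r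
taylor≡weights zero    k x = refl
taylor≡weights (suc n) k x = begin
  taylor (suc n) k (x - 1ℤ)
    ≡⟨ ∑<-last n (λ s → + (k C s) * (x - 1ℤ) ^ s) ⟩
  taylor n k (x - 1ℤ) + c * (x - 1ℤ) ^ n
    ≡⟨ cong₂ (λ u v → u + c * v) (taylor≡weights n k x) expand ⟩
  ∑< n f + c * (∑< n g + x ^ n)
    ≡⟨ ring₁ (∑< n f) c (∑< n g) (x ^ n) ⟩
  ∑< n f + c * ∑< n g + c * x ^ n
    ≡⟨ cong (λ u → ∑< n f + u + c * x ^ n) (*-distribˡ-∑< n c g) ⟩
  ∑< n f + (∑[ r < n ] c * g r) + c * x ^ n
    ≡⟨ cong₂ _+_ (sym (∑<-distrib-+ n f (λ r → c * g r))) (cong (_* x ^ n) (sym (weight-last n k))) ⟩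
  (∑[ r < n ] (f r + c * g r)) + weight (suc n) k n * x ^ n
    ≡⟨ cong (_+ weight (suc n) k n * x ^ n) (∑<-cong n λ r r<n →
        trans (ring₂ (weight n k r) c (+ (n C r)) (x ^ r) (-1ℤ ^ (n ∸ r)))
              (cong (_* x ^ r) (sym (weight-suc n k r r<n)))) ⟩
  (∑[ r < n ] weight (suc n) k r * x ^ r) + weight (suc n) k n * x ^ n
    ≡⟨ ∑<-last n (λ r → weight (suc n) k r * x ^ r) ⟨
  (∑[ r < suc n ] weight (suc n) k r * x ^ r) ∎
  where
  c = + (k C n)
  f g : ℕ → ℤ
  f r = weight n k r * x ^ r
  g r = + (n C r) * (x ^ r * -1ℤ ^ (n ∸ r))
  ring₁ : ∀ a c b y → a + c * (b + y) ≡ a + c * b + c * y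
  ring₁ = solve-∀
  ring₂ : ∀ w a b y e → w * y + a * (b * (y * e)) ≡ (w + a * (b * e)) * y
  ring₂ = solve-∀
  expand : (x - 1ℤ) ^ n ≡ ∑< n g + x ^ n
  expand = begin
    (x - 1ℤ) ^ n        ≡⟨ binomial-theorem n x -1ℤ ⟩
    ∑< (suc n) g        ≡⟨ ∑<-last n g ⟩
    ∑< n g + g n        ≡⟨ cong₂ (λ c e → ∑< n g + + c * (x ^ n * -1ℤ ^ e)) (nCn≡1 n) (ℕ.n∸n≡0 n) ⟩
    ∑< n g + 1ℤ * (x ^ n * 1ℤ)
                        ≡⟨ cong (_+_ (∑< n g)) (trans (ℤ.*-identityˡ (x ^ n * 1ℤ)) (ℤ.*-identityʳ (x ^ n))) ⟩
    ∑< n g + x ^ n      ∎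

[x-1]^n∣interpolation : ∀ n k x → (x - 1ℤ) ^ n ∣ℤ x ^ k - (∑[ r < n ] weight n k r * x ^ r)
[x-1]^n∣interpolation n k x = subst₂ (λ y t → (x - 1ℤ) ^ n ∣ℤ y ^ k - t) (shift x) (taylor≡weights n k x)
  (^-∣-taylor-remainder n k (x - 1ℤ))
  where
  shift : ∀ x → 1ℤ + (x - 1ℤ) ≡ x
  shift = solve-∀

-- Euler's theorem for prime powers

p∤k! : ∀ {p k} → Prime p → k < p → p ∤ k !
p∤k! {p} {zero}  pp k<p p∣1 = contradiction (subst Prime (∣1⇒≡1 p∣1) pp) ¬prime[1]
p∤k! {p} {suc k} pp k<p p∣  with euclidsLemma (suc k) (k !) pp p∣
... | inj₁ p∣1+k = >⇒∤ k<p p∣1+k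
... | inj₂ p∣k!  = p∤k! pp (ℕ.<-trans (ℕ.n<1+n k) k<p) p∣k!

-- The prime p divides p! = C(p,k) k! (p-k)! but neither of the two factorials on the right.
p∣pCk : ∀ {p k} → Prime p → 0 < k → k < p → p ∣ (p C k)
p∣pCk {p} {k} pp 0<k k<p with ℕ.m≤n⇒∃[o]m+o≡n (ℕ.<⇒≤ k<p)
... | d , refl with euclidsLemma ((k ℕ.+ d) C k) (k ! ℕ.* d !) pp
    (subst (k ℕ.+ d ∣_) (sym ([m+n]Cm*m!*n!≡[m+n]! k d)) (p∣p! 0<k))
  where
  p∣p! : ∀ {k} → 0 < k → k ℕ.+ d ∣ (k ℕ.+ d) !
  p∣p! (s≤s _) = m∣m*n _
... | inj₁ p∣C = p∣C
... | inj₂ p∣k!d! with euclidsLemma (k !) (d !) pp p∣k!d!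
...   | inj₁ p∣k! = contradiction p∣k! (p∤k! pp k<p)
...   | inj₂ p∣d! = contradiction p∣d! (p∤k! pp (ℕ.m<n+m d 0<k))

∣⇒+∣ℤ+ : ∀ {m n} → m ∣ n → + m ∣ℤ + n
∣⇒+∣ℤ+ = ℤ∣.∣ᵤ⇒∣

-- Induction on a: in the expansion of (1 + a)^p all terms but the first and the last are divisible
-- by p.
p∣a^p-a : ∀ {p} → Prime p → ∀ a → + p ∣ℤ (+ a) ^ p - + a
p∣a^p-a {zero}  pp a = contradiction pp ¬prime[0]
p∣a^p-a {suc q} pp zero = ℤ∣.divides 0ℤ (cong (_- 0ℤ) (ℤ.*-zeroˡ (0ℤ ^ q)))
p∣a^p-a {p@(suc q)} pp (suc a) = subst (+ p ∣ℤ_) eq (ℤ∣.∣m∣n⇒∣m+n (p∣a^p-a pp a) (∑<-∣ q middle))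
  where
  f : ℕ → ℤ
  f i = + (p C i) * (1ℤ ^ i * (+ a) ^ (p ∸ i))
  middle : ∀ i → i < q → + p ∣ℤ f (suc i)
  middle i i<q = ℤ∣.∣m⇒∣m*n _ (∣⇒+∣ℤ+ (p∣pCk pp (s≤s z≤n) (s≤s i<q)))
  ring : ∀ x a s → (x - a) + s ≡ 1ℤ * (1ℤ * x) + (s + 1ℤ * (1ℤ * 1ℤ)) - (1ℤ + a)
  ring = solve-∀
  eq : (+ a) ^ p - + a + ∑< q (f ∘ suc) ≡ (+ suc a) ^ p - + suc a
  eq = begin
    (+ a) ^ p - + a + ∑< q (f ∘ suc)
      ≡⟨ ring ((+ a) ^ p) (+ a) (∑< q (f ∘ suc)) ⟩
    1ℤ * (1ℤ * (+ a) ^ p) + (∑< q (f ∘ suc) + 1ℤ * (1ℤ * 1ℤ)) - (1ℤ + + a)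
      ≡⟨ cong₂ (λ u v → + u * (1ℤ * (+ a) ^ p) + (∑< q (f ∘ suc) + v) - + suc a) (sym (nC0≡1 p)) (sym last) ⟩
    f 0 + (∑< q (f ∘ suc) + f p) - + suc a
      ≡⟨ cong (λ s → f 0 + s - + suc a) (∑<-last q (f ∘ suc)) ⟨
    ∑< (suc p) f - + suc a
      ≡⟨ cong (_- + suc a) (binomial-theorem p 1ℤ (+ a)) ⟨
    (+ suc a) ^ p - + suc a ∎
    where
    last : f p ≡ 1ℤ * (1ℤ * 1ℤ)
    last = cong₂ (λ c z → + c * z) (nCn≡1 p) (cong₂ (λ z e → z * (+ a) ^ e) (ℤ.^-zeroˡ p) (ℕ.n∸n≡0 p))

fermat : ∀ {q} → Prime (suc q) → ∀ a → suc q ∤ a → + suc q ∣ℤ (+ a) ^ q - 1ℤ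
fermat {q} pp a p∤a with euclidsLemma a ∣ (+ a) ^ q - 1ℤ ∣ pp
    (subst (suc q ∣_) (trans (cong ∣_∣ (ring (+ a) ((+ a) ^ q))) (ℤ.abs-* (+ a) ((+ a) ^ q - 1ℤ)))
      (ℤ∣.∣⇒∣ᵤ (p∣a^p-a pp a)))
  where
  ring : ∀ a x → a * x - a ≡ a * (x - 1ℤ)
  ring = solve-∀
... | inj₁ p∣a = contradiction p∣a p∤a
... | inj₂ p∣  = ℤ∣.∣ᵤ⇒∣ p∣

-- With y = x - 1 and P = p^(m+1), x^p is 1 + p y up to a multiple of y^2. Both p y and y^2 are
-- divisible by p P, the latter because p divides P and P divides y.
lift-exponent : ∀ p m x → + (p ℕ.^ suc m) ∣ℤ x - 1ℤ → + (p ℕ.^ suc (suc m)) ∣ℤ x ^ p - 1ℤ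
lift-exponent p m x P∣y = subst (+ (p ℕ.* P) ∣ℤ_) eq
  (ℤ∣.∣m∣n⇒∣m+n (ℤ∣.∣-trans pP∣y² (^-∣-taylor-remainder 2 p y))
    (subst (_∣ℤ + p * y) (sym (ℤ.pos-* p P)) (ℤ∣.*-monoʳ-∣ (+ p) P∣y)))
  where
  P = p ℕ.^ suc m
  y = x - 1ℤ
  pP∣y² : + (p ℕ.* P) ∣ℤ y ^ 2
  pP∣y² = ℤ∣.∣-trans (subst (_∣ℤ + P * + P) (sym (ℤ.pos-* p P)) (ℤ∣.*-monoˡ-∣ (+ P) (∣⇒+∣ℤ+ {p} {P} (m∣m*n (p ℕ.^ m)))))
    (ℤ∣.∣-trans (ℤ∣.*-monoʳ-∣ (+ P) P∣y)
      (subst (+ P * y ∣ℤ_) (cong (y *_) (sym (ℤ.*-identityʳ y))) (ℤ∣.*-monoˡ-∣ y P∣y)))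
  ring : ∀ z p y → z - (1ℤ * 1ℤ + (p * (y * 1ℤ) + 0ℤ)) + p * y ≡ z - 1ℤ
  ring = solve-∀
  eq : (1ℤ + y) ^ p - taylor 2 p y + + p * y ≡ x ^ p - 1ℤ
  eq = begin
    (1ℤ + y) ^ p - (+ (p C 0) * 1ℤ + (+ (p C 1) * (y * 1ℤ) + 0ℤ)) + + p * y
      ≡⟨ cong₂ (λ c d → (1ℤ + y) ^ p - (+ c * 1ℤ + (+ d * (y * 1ℤ) + 0ℤ)) + + p * y) (nC0≡1 p) (nC1≡n p) ⟩
    (1ℤ + y) ^ p - (1ℤ * 1ℤ + (+ p * (y * 1ℤ) + 0ℤ)) + + p * y
      ≡⟨ ring ((1ℤ + y) ^ p) (+ p) y ⟩
    (1ℤ + y) ^ p - 1ℤ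
      ≡⟨ cong (λ z → z ^ p - 1ℤ) (shift x) ⟩
    x ^ p - 1ℤ ∎
    where
    shift : ∀ x → 1ℤ + (x - 1ℤ) ≡ x
    shift = solve-∀

-- `lift-exponent` is applied m times to Fermat's congruence. The exponent p^m (p - 1) is identified
-- with the totient of p^(m+1) in `φ[p^m]`.
euler-prime-power : ∀ {q} → Prime (suc q) → ∀ m a → suc q ∤ a →
  + (suc q ℕ.^ suc m) ∣ℤ (+ a) ^ (suc q ℕ.^ m ℕ.* q) - 1ℤ
euler-prime-power {q} pp zero    a p∤a = subst₂ (λ P e → + P ∣ℤ (+ a) ^ e - 1ℤ)
  (sym (ℕ.*-identityʳ (suc q))) (sym (ℕ.*-identityˡ q)) (fermat pp a p∤a)
euler-prime-power {q} pp (suc m) a p∤a = subst (λ z → + (suc q ℕ.^ suc (suc m)) ∣ℤ z - 1ℤ)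
  (trans (ℤ.^-*-assoc (+ a) (suc q ℕ.^ m ℕ.* q) (suc q))
    (cong ((+ a) ^_) (trans (ℕ.*-comm (suc q ℕ.^ m ℕ.* q) (suc q))
      (sym (ℕ.*-assoc (suc q) (suc q ℕ.^ m) q)))))
  (lift-exponent (suc q) m ((+ a) ^ (suc q ℕ.^ m ℕ.* q)) (euler-prime-power pp m a p∤a))

-- Euler's totient at prime powers

coprime-prime-power : ∀ {p} → Prime p → ∀ m a → p ∤ a → Coprime a (p ℕ.^ m)
coprime-prime-power pp zero    a p∤a (_ , d∣1) = ∣1⇒≡1 d∣1
-- Since d divides a, it is not divisible by p and so is coprime to p; one factor p of p^(m+1) can
-- therefore be dropped.
coprime-prime-power {p} pp (suc m) a p∤a {d} (d∣a , d∣p^) =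
  coprime-prime-power pp m a p∤a (d∣a , coprime-divisor d⊥p d∣p^)
  where
  d⊥p : Coprime d p
  d⊥p (e∣d , e∣p) with prime⇒irreducible pp e∣p
  ... | inj₁ e≡1 = e≡1
  ... | inj₂ refl = contradiction (∣-trans e∣d d∣a) p∤a

p∣a⇒¬coprime : ∀ {p} → Prime p → ∀ m a → p ∣ a → ¬ Coprime a (p ℕ.^ suc m)
p∣a⇒¬coprime {p} pp m a p∣a a⊥p^ =
  contradiction (subst Prime (a⊥p^ (p∣a , m∣m*n (p ℕ.^ m))) pp) ¬prime[1]

applyUpTo-++ : ∀ {A : Set} m n (f : ℕ → A) → applyUpTo f (m ℕ.+ n) ≡ applyUpTo f m ++ applyUpTo (f ∘ (m ℕ.+_)) n
applyUpTo-++ zero    n f = refl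
applyUpTo-++ (suc m) n f = cong (f 0 ∷_) (applyUpTo-++ m n (f ∘ suc))

module _ {q} (pp : Prime (suc q)) (m : ℕ) where
  private
    p = suc q
    N = p ℕ.^ suc m
    P? = λ a → coprime? a N

    -- Of the integers c + 1, ..., c + p after a multiple c of p, exactly the last is divisible by
    -- p.
    block : ∀ c → p ∣ c → length (filter P? (applyUpTo (λ i → c ℕ.+ suc i) p)) ≡ q
    block c p∣c = begin
      length (filter P? (applyUpTo (λ i → c ℕ.+ suc i) p))
        ≡⟨ cong (length ∘ filter P?) (applyUpTo-∷ʳ (λ i → c ℕ.+ suc i) q) ⟨
      length (filter P? (xs ∷ʳ (c ℕ.+ p)))
        ≡⟨ cong length (filter-++ P? xs _) ⟩
      length (filter P? xs ++ filter P? (c ℕ.+ p ∷ []))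
        ≡⟨ cong₂ (λ u v → length (u ++ v))
             (filter-all P? (applyUpTo⁺₁ (λ i → c ℕ.+ suc i) q λ {i} i<q →
                coprime-prime-power pp (suc m) (c ℕ.+ suc i) λ p∣ → >⇒∤ (s≤s i<q) (∣m+n∣m⇒∣n p∣ p∣c)))
             (filter-reject P? (p∣a⇒¬coprime pp m (c ℕ.+ p) (∣m∣n⇒∣m+n p∣c ∣-refl))) ⟩
      length (xs ++ [])
        ≡⟨ length-++ xs ⟩
      length xs ℕ.+ 0
        ≡⟨ ℕ.+-identityʳ _ ⟩
      length xs
        ≡⟨ length-applyUpTo _ q ⟩
      q ∎
      where xs = applyUpTo (λ i → c ℕ.+ suc i) q

    count : ∀ c n → p ∣ c → length (filter P? (applyUpTo (λ i → c ℕ.+ suc i) (n ℕ.* p))) ≡ n ℕ.* q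
    count c zero    p∣c = refl
    count c (suc n) p∣c = begin
      length (filter P? (applyUpTo f (p ℕ.+ n ℕ.* p)))
        ≡⟨ cong (length ∘ filter P?) (applyUpTo-++ p (n ℕ.* p) f) ⟩
      length (filter P? (applyUpTo f p ++ applyUpTo (f ∘ (p ℕ.+_)) (n ℕ.* p)))
        ≡⟨ cong length (filter-++ P? (applyUpTo f p) _) ⟩
      length (filter P? (applyUpTo f p) ++ filter P? (applyUpTo (f ∘ (p ℕ.+_)) (n ℕ.* p)))
        ≡⟨ length-++ (filter P? (applyUpTo f p)) ⟩
      length (filter P? (applyUpTo f p)) ℕ.+ length (filter P? (applyUpTo (f ∘ (p ℕ.+_)) (n ℕ.* p)))
        ≡⟨ cong₂ ℕ._+_ (block c p∣c) (trans (cong (length ∘ filter P?) (applyUpTo-cong (n ℕ.* p) shift))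
             (count (c ℕ.+ p) n (∣m∣n⇒∣m+n p∣c ∣-refl))) ⟩
      q ℕ.+ n ℕ.* q ∎
      where
      f : ℕ → ℕ
      f i = c ℕ.+ suc i
      shift : ∀ i → c ℕ.+ suc (p ℕ.+ i) ≡ c ℕ.+ p ℕ.+ suc i
      shift i = trans (cong (c ℕ.+_) (sym (ℕ.+-suc p i))) (sym (ℕ.+-assoc c p (suc i)))
      applyUpTo-cong : ∀ n {g h : ℕ → ℕ} → (∀ i → g i ≡ h i) → applyUpTo g n ≡ applyUpTo h n
      applyUpTo-cong zero    g≗h = refl
      applyUpTo-cong (suc n) g≗h = cong₂ _∷_ (g≗h 0) (applyUpTo-cong n (g≗h ∘ suc))

  φ[p^m] : φ N ≡ p ℕ.^ m ℕ.* q
  -- The range 1, ..., p^(m+1) is cut into p^m blocks of length p, the first one starting after c =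
  -- 0.
  φ[p^m] = trans (cong (λ l → length (filter P? (applyUpTo suc l))) (ℕ.*-comm p (p ℕ.^ m)))
    (count 0 (p ℕ.^ m) (divides 0 refl))

n<m^n : ∀ m n → 1 < m → n < m ℕ.^ n
n<m^n m zero    1<m = s≤s z≤n
n<m^n m (suc n) 1<m = ℕ.≤-<-trans (n<m^n m n 1<m) (ℕ.^-monoʳ-< m 1<m (ℕ.n<1+n n))

-- Makes p^e vanish modulo p^m once e is at least φ(p^m), as the case n = 1 requires. For exponent m
-- + 1 the bound comes from m < p^m ≤ p^m (p - 1).
m≤φ[p^m] : ∀ {p} → Prime p → ∀ m → m ≤ φ (p ℕ.^ m)
m≤φ[p^m] {zero}        pp m = contradiction pp ¬prime[0]
m≤φ[p^m] {suc zero}    pp m = contradiction pp ¬prime[1]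
m≤φ[p^m] {suc (suc q)} pp zero = z≤n
m≤φ[p^m] {p@(suc (suc q))} pp (suc m) = subst (suc m ≤_) (sym (φ[p^m] pp m))
  (ℕ.≤-trans (n<m^n p m (s≤s (s≤s z≤n))) (ℕ.m≤m*n (p ℕ.^ m) (suc q)))

i^m∣i^n : ∀ i {m n} → m ≤ n → i ^ m ∣ℤ i ^ n
i^m∣i^n i {m} m≤n with ℕ.m≤n⇒∃[o]m+o≡n m≤n
... | d , refl = subst (i ^ m ∣ℤ_) (sym (ℤ.^-distribˡ-+-* i m d)) (ℤ∣.∣m⇒∣m*n (i ^ d) ℤ∣.∣-refl)

pos-^ : ∀ m n → (+ m) ^ n ≡ + (m ℕ.^ n)
pos-^ m zero    = refl
pos-^ m (suc n) = trans (cong (+ m *_) (pos-^ m n)) (sym (ℤ.pos-* m (m ℕ.^ n)))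

-- The recursion for U and power sums twisted by c

-- The coefficients of x / (1 - x + x²).
c : ℕ → ℤ
c zero          = 0ℤ
c (suc zero)    = 1ℤ
c (suc (suc n)) = c (suc n) - c n

-- Reflects the divisibility of 1 + x³ by 1 - x + x².
c-antiperiodic : ∀ i → c (3 ℕ.+ i) ≡ -1ℤ * c i
c-antiperiodic i = ring (c (suc i)) (c i)
  where
  ring : ∀ u v → u - v - u ≡ -1ℤ * v
  ring = solve-∀

c-periodic : ∀ n i → c (n ℕ.* 6 ℕ.+ i) ≡ c i
c-periodic zero    i = refl
c-periodic (suc n) i = begin
  c (6 ℕ.+ (n ℕ.* 6 ℕ.+ i))          ≡⟨ c-antiperiodic (3 ℕ.+ (n ℕ.* 6 ℕ.+ i)) ⟩
  -1ℤ * c (3 ℕ.+ (n ℕ.* 6 ℕ.+ i))    ≡⟨ cong (-1ℤ *_) (c-antiperiodic (n ℕ.* 6 ℕ.+ i)) ⟩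
  -1ℤ * (-1ℤ * c (n ℕ.* 6 ℕ.+ i))    ≡⟨ ring (c (n ℕ.* 6 ℕ.+ i)) ⟩
  c (n ℕ.* 6 ℕ.+ i)                  ≡⟨ c-periodic n i ⟩
  c i                                ∎
  where
  ring : ∀ u → -1ℤ * (-1ℤ * u) ≡ u
  ring = solve-∀

c[i*3]≡0 : ∀ i → c (i ℕ.* 3) ≡ 0ℤ
c[i*3]≡0 zero    = refl
c[i*3]≡0 (suc i) = trans (c-antiperiodic (i ℕ.* 3)) (cong (-1ℤ *_) (c[i*3]≡0 i))

-- The case p ≡ 5 (mod 6): 5i ≡ -i modulo the period 6, and c extends to an odd function. The
-- induction proceeds in steps of the antiperiod 3.
c[i*5]≡-c[i] : ∀ i → c (i ℕ.* 5) ≡ -1ℤ * c i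
c[i*5]≡-c[i] 0 = refl
c[i*5]≡-c[i] 1 = refl
c[i*5]≡-c[i] 2 = refl
c[i*5]≡-c[i] (suc (suc (suc i))) = begin
  c (15 ℕ.+ i ℕ.* 5)              ≡⟨ c-periodic 2 (3 ℕ.+ i ℕ.* 5) ⟩
  c (3 ℕ.+ i ℕ.* 5)               ≡⟨ c-antiperiodic (i ℕ.* 5) ⟩
  -1ℤ * c (i ℕ.* 5)               ≡⟨ cong (-1ℤ *_) (c[i*5]≡-c[i] i) ⟩
  -1ℤ * (-1ℤ * c i)               ≡⟨ cong (-1ℤ *_) (c-antiperiodic i) ⟨
  -1ℤ * c (3 ℕ.+ i)               ∎

⟨/3⟩-cong : ∀ {m n} → m ℕ.% 3 ≡ n ℕ.% 3 → ⟨ m /3⟩ ≡ ⟨ n /3⟩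
⟨/3⟩-cong {m} {n} eq with m ℕ.% 3 | n ℕ.% 3
⟨/3⟩-cong refl | _ | _ = refl

-- Only p modulo 6 matters, and the odd residues 1, 3, 5 give the factors 1, 0, -1. Oddness is
-- essential: c(2) = 1 whereas (2/3) = -1.
c[i*p]≡⟨p/3⟩*c[i] : ∀ p → 2 ∤ p → ∀ i → c (i ℕ.* p) ≡ ⟨ p /3⟩ * c i
c[i*p]≡⟨p/3⟩*c[i] p 2∤p i = subst (λ p → c (i ℕ.* p) ≡ ⟨ p /3⟩ * c i) (sym p≡)
  (begin
    c (i ℕ.* (r ℕ.+ s ℕ.* 6))   ≡⟨ cong c (ring i r s) ⟩
    c (i ℕ.* s ℕ.* 6 ℕ.+ i ℕ.* r) ≡⟨ c-periodic (i ℕ.* s) (i ℕ.* r) ⟩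
    c (i ℕ.* r)                 ≡⟨ cases r (m%n<n p 6) 2∤r ⟩
    ⟨ r /3⟩ * c i               ≡⟨ cong (_* c i) (⟨/3⟩-cong {r} {r ℕ.+ s ℕ.* 6} mod3) ⟩
    ⟨ r ℕ.+ s ℕ.* 6 /3⟩ * c i   ∎)
  where
  r = p ℕ.% 6
  s = p ℕ./ 6
  p≡ : p ≡ r ℕ.+ s ℕ.* 6
  p≡ = m≡m%n+[m/n]*n p 6
  mod3 : r ℕ.% 3 ≡ (r ℕ.+ s ℕ.* 6) ℕ.% 3
  mod3 = sym (trans (cong (λ t → (r ℕ.+ t) ℕ.% 3) (sym (ℕ.*-assoc s 2 3))) ([m+kn]%n≡m%n r (s ℕ.* 2) 3))
  ring : ∀ i r s → i ℕ.* (r ℕ.+ s ℕ.* 6) ≡ i ℕ.* s ℕ.* 6 ℕ.+ i ℕ.* r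
  ring = ℕ-solve-∀
  2∤r : 2 ∤ r
  2∤r (divides d r≡) = 2∤p (divides (d ℕ.+ s ℕ.* 3)
    (trans p≡ (trans (cong (ℕ._+ s ℕ.* 6) r≡) (ring₂ d s))))
    where
    ring₂ : ∀ d s → d ℕ.* 2 ℕ.+ s ℕ.* 6 ≡ (d ℕ.+ s ℕ.* 3) ℕ.* 2
    ring₂ = ℕ-solve-∀
  cases : ∀ r → r < 6 → 2 ∤ r → c (i ℕ.* r) ≡ ⟨ r /3⟩ * c i
  cases 0 _ 2∤r = contradiction (divides 0 refl) 2∤r
  cases 1 _ _   = trans (cong c (ℕ.*-identityʳ i)) (sym (ℤ.*-identityˡ (c i)))
  cases 2 _ 2∤r = contradiction (divides 1 refl) 2∤r
  cases 3 _ _   = c[i*3]≡0 i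
  cases 4 _ 2∤r = contradiction (divides 2 refl) 2∤r
  cases 5 _ _   = c[i*5]≡-c[i] i
  cases (suc (suc (suc (suc (suc (suc r)))))) (s≤s (s≤s (s≤s (s≤s (s≤s (s≤s ())))))) _

-- Odd moduli

Odd : ℕ → Set
Odd n = ∃ λ t → n ≡ suc (t ℕ.* 2)

2∤⇒odd : ∀ n → 2 ∤ n → Odd n
2∤⇒odd n 2∤n with n ℕ.% 2 in eq | m≡m%n+[m/n]*n n 2 | m%n<n n 2
... | 0 | n≡ | _ = contradiction (divides (n ℕ./ 2) n≡) 2∤n
... | 1 | n≡ | _ = n ℕ./ 2 , n≡
... | suc (suc _) | _ | s≤s (s≤s ())

odd-* : ∀ {m n} → Odd m → Odd n → Odd (m ℕ.* n)
odd-* (s , refl) (t , refl) = s ℕ.+ t ℕ.+ s ℕ.* t ℕ.* 2 , ring s t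
  where
  ring : ∀ s t → (1 ℕ.+ s ℕ.* 2) ℕ.* (1 ℕ.+ t ℕ.* 2) ≡ 1 ℕ.+ (s ℕ.+ t ℕ.+ s ℕ.* t ℕ.* 2) ℕ.* 2
  ring = ℕ-solve-∀

odd-^ : ∀ {m} → Odd m → ∀ n → Odd (m ℕ.^ n)
odd-^ o zero    = 0 , refl
odd-^ o (suc n) = odd-* o (odd-^ o n)

-- For M = 2t + 1 one has z = M z - t (2 z).
odd∣2z⇒odd∣z : ∀ {M} → Odd M → ∀ z → + M ∣ℤ + 2 * z → + M ∣ℤ z
odd∣2z⇒odd∣z (t , refl) z M∣2z = subst (+ suc (t ℕ.* 2) ∣ℤ_)
  (trans (cong (λ m → (1ℤ + m) * z - + t * (+ 2 * z)) (ℤ.pos-* t 2)) (ring (+ t) z))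
  (ℤ∣.∣m∣n⇒∣m-n (ℤ∣.∣m⇒∣m*n z ℤ∣.∣-refl) (ℤ∣.∣n⇒∣m*n (+ t) M∣2z))
  where
  ring : ∀ t z → (1ℤ + t * + 2) * z - t * (+ 2 * z) ≡ z
  ring = solve-∀

-- For odd K, 3K + 1 ≡ 4 modulo the period 6, and c(4) = -1; an even K would give c(1) = 1.
c[1+odd*3]≡-1 : ∀ {K} → Odd K → c (suc (K ℕ.* 3)) ≡ -1ℤ
c[1+odd*3]≡-1 (t , refl) = trans (cong c (ring t)) (c-periodic t 4)
  where
  ring : ∀ t → 1 ℕ.+ (1 ℕ.+ t ℕ.* 2) ℕ.* 3 ≡ t ℕ.* 6 ℕ.+ 4
  ring = ℕ-solve-∀

-- The recurrence for `c` cancels the coefficient of every interior value of f, so only boundary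
-- terms survive. Integer arguments are needed because j = 0 involves f(-1), with coefficient c(0) =
-- 0.
c-by-parts : ∀ N (f : ℤ → ℤ) →
  (∑[ j < N ] c j * (f (1ℤ + + j) - f (+ j) + f (-1ℤ + + j)))
    ≡ f 0ℤ - c N * f (-1ℤ + + N) + (c N - c (suc N)) * f (+ N)
c-by-parts zero    f = ring (f 0ℤ) (f -1ℤ)
  where
  ring : ∀ u v → 0ℤ ≡ u - 0ℤ * v + (0ℤ - 1ℤ) * u
  ring = solve-∀
c-by-parts (suc N) f = begin
  (∑[ j < suc N ] c j * (f (1ℤ + + j) - f (+ j) + f (-1ℤ + + j)))
    ≡⟨ ∑<-last N (λ j → c j * (f (1ℤ + + j) - f (+ j) + f (-1ℤ + + j))) ⟩
  (∑[ j < N ] c j * (f (1ℤ + + j) - f (+ j) + f (-1ℤ + + j))) + c N * (f (+ suc N) - f (+ N) + f (-1ℤ + + N))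
    ≡⟨ cong (_+ c N * (f (+ suc N) - f (+ N) + f (-1ℤ + + N))) (c-by-parts N f) ⟩
  f 0ℤ - c N * f (-1ℤ + + N) + (c N - c (suc N)) * f (+ N) + c N * (f (+ suc N) - f (+ N) + f (-1ℤ + + N))
    ≡⟨ ring (f 0ℤ) (c N) (c (suc N)) (f (-1ℤ + + N)) (f (+ N)) (f (+ suc N)) ⟩
  -- The inner difference c(N+1) - c(N) is c(N+2), by definition.
  f 0ℤ - c (suc N) * f (+ N) + (c (suc N) - (c (suc N) - c N)) * f (+ suc N) ∎
  where
  ring : ∀ f₀ c d u v w → f₀ - c * u + (c - d) * v + c * (w - v + u)
                        ≡ f₀ - d * v + (d - (d - c)) * w
  ring = solve-∀

-- The factor 1 + (-1)^i is 2 or 0 according to the parity of i, and ⌊(n+1)/2⌋ of the indices below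
-- n are even.
∑-even : ∀ n (a : ℕ → ℤ) →
  (∑[ i < n ] (1ℤ ^ i + -1ℤ ^ i) * a i) ≡ + 2 * (∑[ k < ⌊ suc n /2⌋ ] a (2 ℕ.* k))
∑-even zero          a = refl
∑-even (suc zero)    a = trans (ℤ.+-identityʳ (+ 2 * a 0)) (cong (+ 2 *_) (sym (ℤ.+-identityʳ (a 0))))
∑-even (suc (suc n)) a = begin
  + 2 * a 0 + ((1ℤ * 1ℤ + -1ℤ * 1ℤ) * a 1 + (∑[ i < n ] (1ℤ * (1ℤ * 1ℤ ^ i) + -1ℤ * (-1ℤ * -1ℤ ^ i)) * a (2 ℕ.+ i)))
    ≡⟨ cong (λ z → + 2 * a 0 + (0ℤ * a 1 + z)) (∑<-cong n λ i _ → ring₁ (1ℤ ^ i) (-1ℤ ^ i) (a (2 ℕ.+ i))) ⟩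
  + 2 * a 0 + (0ℤ * a 1 + (∑[ i < n ] (1ℤ ^ i + -1ℤ ^ i) * a (2 ℕ.+ i)))
    ≡⟨ cong (λ z → + 2 * a 0 + (0ℤ * a 1 + z)) (∑-even n (λ i → a (2 ℕ.+ i))) ⟩
  + 2 * a 0 + (0ℤ * a 1 + + 2 * (∑[ k < ⌊ suc n /2⌋ ] a (2 ℕ.+ 2 ℕ.* k)))
    ≡⟨ ring₂ (a 0) (a 1) (∑[ k < ⌊ suc n /2⌋ ] a (2 ℕ.+ 2 ℕ.* k)) ⟩
  + 2 * (a 0 + (∑[ k < ⌊ suc n /2⌋ ] a (2 ℕ.+ 2 ℕ.* k)))
    ≡⟨ cong (λ z → + 2 * (a 0 + z)) (∑<-cong ⌊ suc n /2⌋ λ k _ → cong a (sym (ℕ.*-suc 2 k))) ⟩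
  + 2 * (a 0 + (∑[ k < ⌊ suc n /2⌋ ] a (2 ℕ.* suc k))) ∎
  where
  ring₁ : ∀ u v a → (1ℤ * (1ℤ * u) + -1ℤ * (-1ℤ * v)) * a ≡ (u + v) * a
  ring₁ = solve-∀
  ring₂ : ∀ a b s → + 2 * a + (0ℤ * b + + 2 * s) ≡ + 2 * (a + s)
  ring₂ = solve-∀

-- The odd powers of 1 and -1 cancel in the two binomial expansions. The right-hand side is modelled
-- on the recursion for `U`: replacing each power y^i by U(i) turns it into 0 for n ≥ 1.
second-difference : ∀ n y → (1ℤ + y) ^ n - y ^ n + (-1ℤ + y) ^ n
  ≡ y ^ n + + 2 * (∑[ k < ⌊ n /2⌋ ] + (n C (2 ℕ.* suc k)) * y ^ (n ∸ 2 ℕ.* suc k))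
second-difference n y = begin
  (1ℤ + y) ^ n - y ^ n + (-1ℤ + y) ^ n
    ≡⟨ cong₂ (λ u v → u - y ^ n + v) (binomial-theorem n 1ℤ y) (binomial-theorem n -1ℤ y) ⟩
  ∑< (suc n) f - y ^ n + ∑< (suc n) g
    ≡⟨ ring₁ (∑< (suc n) f) (y ^ n) (∑< (suc n) g) ⟩
  (∑< (suc n) f + ∑< (suc n) g) - y ^ n
    ≡⟨ cong (_- y ^ n) (∑<-distrib-+ (suc n) f g) ⟨
  (∑[ i < suc n ] (f i + g i)) - y ^ n
    ≡⟨ cong (_- y ^ n) (∑<-cong (suc n) λ i _ → ring₂ (+ (n C i)) (1ℤ ^ i) (-1ℤ ^ i) (y ^ (n ∸ i))) ⟩
  (∑[ i < suc n ] (1ℤ ^ i + -1ℤ ^ i) * a i) - y ^ n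
    -- Index 0 splits off because ⌊(n+2)/2⌋ reduces to 1 + ⌊n/2⌋; of its contribution 2 y^n, one y^n
    -- survives the subtraction.
    ≡⟨ cong (_- y ^ n) (∑-even (suc n) a) ⟩
  + 2 * (a 0 + s) - y ^ n
    ≡⟨ cong (λ z → + 2 * (+ z * y ^ n + s) - y ^ n) (nC0≡1 n) ⟩
  + 2 * (1ℤ * y ^ n + s) - y ^ n
    ≡⟨ ring₃ (y ^ n) s ⟩
  y ^ n + + 2 * s ∎
  where
  f g a : ℕ → ℤ
  f i = + (n C i) * (1ℤ ^ i * y ^ (n ∸ i))
  g i = + (n C i) * (-1ℤ ^ i * y ^ (n ∸ i))
  a i = + (n C i) * y ^ (n ∸ i)
  s = ∑[ k < ⌊ n /2⌋ ] a (2 ℕ.* suc k)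
  ring₁ : ∀ u v w → u - v + w ≡ u + w - v
  ring₁ = solve-∀
  ring₂ : ∀ b u v z → b * (u * z) + b * (v * z) ≡ (u + v) * (b * z)
  ring₂ = solve-∀
  ring₃ : ∀ z s → + 2 * (1ℤ * z + s) - z ≡ z + + 2 * s
  ring₃ = solve-∀

T : ℕ → ℕ → ℤ
T N n = ∑[ j < N ] c j * (+ j) ^ n

-- `second-difference` at y = j, weighted by c(j) and summed over j, is evaluated by `c-by-parts`;
-- the two hypotheses turn the boundary terms into 0^n + N^n.
T-rec : ∀ N n → c N ≡ 0ℤ → c (suc N) ≡ -1ℤ →
  T N n + + 2 * (∑[ k < ⌊ n /2⌋ ] + (n C (2 ℕ.* suc k)) * T N (n ∸ 2 ℕ.* suc k)) ≡ 0ℤ ^ n + (+ N) ^ n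
T-rec N n cN≡0 cN+1≡-1 = begin
  T N n + + 2 * (∑[ k < l ] b k * T N (e k))
    ≡⟨ cong (λ z → T N n + + 2 * z) (∑<-cong l λ k _ → *-distribˡ-∑< N (b k) (λ j → c j * (+ j) ^ e k)) ⟩
  T N n + + 2 * (∑[ k < l ] ∑[ j < N ] b k * (c j * (+ j) ^ e k))
    ≡⟨ cong (λ z → T N n + + 2 * z) (∑<-comm l N (λ k j → b k * (c j * (+ j) ^ e k))) ⟩
  T N n + + 2 * (∑[ j < N ] ∑[ k < l ] b k * (c j * (+ j) ^ e k))
    ≡⟨ cong (λ z → T N n + + 2 * z) (∑<-cong N λ j _ → trans
         (∑<-cong l λ k _ → ring₁ (b k) (c j) ((+ j) ^ e k))
         (sym (*-distribˡ-∑< l (c j) (λ k → b k * (+ j) ^ e k)))) ⟩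
  T N n + + 2 * (∑[ j < N ] c j * s j)
    ≡⟨ cong (_+_ (T N n)) (*-distribˡ-∑< N (+ 2) (λ j → c j * s j)) ⟩
  T N n + (∑[ j < N ] + 2 * (c j * s j))
    ≡⟨ ∑<-distrib-+ N (λ j → c j * (+ j) ^ n) (λ j → + 2 * (c j * s j)) ⟨
  (∑[ j < N ] (c j * (+ j) ^ n + + 2 * (c j * s j)))
    ≡⟨ ∑<-cong N (λ j _ → trans (ring₂ (c j) ((+ j) ^ n) (s j)) (cong (c j *_) (sym (second-difference n (+ j))))) ⟩
  (∑[ j < N ] c j * ((1ℤ + + j) ^ n - (+ j) ^ n + (-1ℤ + + j) ^ n))
    ≡⟨ c-by-parts N (_^ n) ⟩
  0ℤ ^ n - c N * (-1ℤ + + N) ^ n + (c N - c (suc N)) * (+ N) ^ n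
    ≡⟨ cong₂ (λ u v → 0ℤ ^ n - u * (-1ℤ + + N) ^ n + (u - v) * (+ N) ^ n) cN≡0 cN+1≡-1 ⟩
  0ℤ ^ n - 0ℤ * (-1ℤ + + N) ^ n + (0ℤ - -1ℤ) * (+ N) ^ n
    ≡⟨ ring₃ (0ℤ ^ n) ((-1ℤ + + N) ^ n) ((+ N) ^ n) ⟩
  0ℤ ^ n + (+ N) ^ n ∎
  where
  l = ⌊ n /2⌋
  b : ℕ → ℤ
  b k = + (n C (2 ℕ.* suc k))
  e : ℕ → ℕ
  e k = n ∸ 2 ℕ.* suc k
  s : ℕ → ℤ
  s j = ∑[ k < l ] b k * (+ j) ^ e k
  ring₁ : ∀ b c z → b * (c * z) ≡ c * (b * z)
  ring₁ = solve-∀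
  ring₂ : ∀ c z s → c * z + + 2 * (c * s) ≡ c * (z + + 2 * s)
  ring₂ = solve-∀
  ring₃ : ∀ u v w → u - 0ℤ * v + (0ℤ - -1ℤ) * w ≡ u + w
  ring₃ = solve-∀

-- For n ≥ 1 the sums T satisfy the recursion of `U` up to N^n; the factor 2 comes from their
-- initial value.
N∣2U-T : ∀ {N} → c N ≡ 0ℤ → c (suc N) ≡ -1ℤ → ∀ n → + N ∣ℤ + 2 * U n - T N n
N∣2U-T {N} cN≡0 cN+1≡-1 = <-rec _ step
  where
  step : ∀ n → (∀ {y} → y < n → + N ∣ℤ + 2 * U y - T N y) → + N ∣ℤ + 2 * U n - T N n
  -- For n = 0 the inner sum of `T-rec` is empty, and 0^0 + N^0 = 2 = 2 U(0).
  step zero    _  = ℤ∣.divides 0ℤ (cong (λ t → + 2 - t) (trans (sym (ℤ.+-identityʳ (T N 0))) (T-rec N 0 cN≡0 cN+1≡-1)))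
  -- The two recursions combine to 2 U(n) - T(n) = -2 ∑ C(n,2k) (2 U(n-2k) - T(n-2k)) - N^n.
  step n@(suc n-1) ih = subst (+ N ∣ℤ_) eq
    (ℤ∣.∣m∣n⇒∣m-n (ℤ∣.∣n⇒∣m*n (- + 2) (∑<-∣ l λ k _ → ℤ∣.∣n⇒∣m*n (b k) (ih (s≤s (ℕ.m∸n≤m n-1 (k ℕ.+ 1 ℕ.* suc k))))))
      (ℤ∣.∣m⇒∣m*n ((+ N) ^ n-1) ℤ∣.∣-refl))
    where
    l = ⌊ n /2⌋
    b : ℕ → ℤ
    b k = + (n C (2 ℕ.* suc k))
    e : ℕ → ℕ
    e k = n ∸ 2 ℕ.* suc k
    u t : ℤ
    u = ∑[ k < l ] b k * U (e k)
    t = ∑[ k < l ] b k * T N (e k)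
    ring₁ : ∀ b u t → b * (+ 2 * u - t) ≡ + 2 * (b * u) + -1ℤ * (b * t)
    ring₁ = solve-∀
    ring₂ : ∀ u t s → - + 2 * (+ 2 * u + -1ℤ * t) - s ≡ + 2 * (- + 2 * u) - (0ℤ + s - + 2 * t)
    ring₂ = solve-∀
    ring₃ : ∀ x y → x + y - y ≡ x
    ring₃ = solve-∀
    diff : (∑[ k < l ] b k * (+ 2 * U (e k) - T N (e k))) ≡ + 2 * u + -1ℤ * t
    diff = begin
      (∑[ k < l ] b k * (+ 2 * U (e k) - T N (e k)))
        ≡⟨ ∑<-cong l (λ k _ → ring₁ (b k) (U (e k)) (T N (e k))) ⟩
      (∑[ k < l ] (+ 2 * (b k * U (e k)) + -1ℤ * (b k * T N (e k))))
        ≡⟨ ∑<-distrib-+ l (λ k → + 2 * (b k * U (e k))) (λ k → -1ℤ * (b k * T N (e k))) ⟩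
      (∑[ k < l ] + 2 * (b k * U (e k))) + (∑[ k < l ] -1ℤ * (b k * T N (e k)))
        ≡⟨ cong₂ _+_ (*-distribˡ-∑< l (+ 2) (λ k → b k * U (e k))) (*-distribˡ-∑< l -1ℤ (λ k → b k * T N (e k))) ⟨
      + 2 * u + -1ℤ * t ∎
    eq : - + 2 * (∑[ k < l ] b k * (+ 2 * U (e k) - T N (e k))) - (+ N) ^ n ≡ + 2 * U n - T N n
    eq = begin
      - + 2 * (∑[ k < l ] b k * (+ 2 * U (e k) - T N (e k))) - (+ N) ^ n
        ≡⟨ cong (λ z → - + 2 * z - (+ N) ^ n) diff ⟩
      - + 2 * (+ 2 * u + -1ℤ * t) - (+ N) ^ n
        ≡⟨ ring₂ u t ((+ N) ^ n) ⟩
      -- The `0ℤ` in the bracket is 0^n, which reduces because n is positive.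
      + 2 * (- + 2 * u) - (0ℤ + (+ N) ^ n - + 2 * t)
        ≡⟨ cong₂ (λ x y → + 2 * x - (y - + 2 * t)) (sym (U-rec n)) (sym (T-rec N n cN≡0 cN+1≡-1)) ⟩
      + 2 * U n - (T N n + + 2 * t - + 2 * t)
        ≡⟨ cong (λ z → + 2 * U n - z) (ring₃ (T N n) (+ 2 * t)) ⟩
      + 2 * U n - T N n ∎

-- Interpolation

^-distrib-* : ∀ x y n → (x * y) ^ n ≡ x ^ n * y ^ n
^-distrib-* x y zero    = refl
^-distrib-* x y (suc n) = trans (cong (x * y *_) (^-distrib-* x y n)) (ring x y (x ^ n) (y ^ n))
  where
  ring : ∀ x y u v → x * y * (u * v) ≡ x * u * (y * v)
  ring = solve-∀

^-mono-∣ : ∀ {x y} n → x ∣ℤ y → x ^ n ∣ℤ y ^ n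
^-mono-∣ {x} n (ℤ∣.divides q refl) = ℤ∣.divides (q ^ n) (^-distrib-* q x n)

-- The values of `U` with the Euler factor at p removed; twice this is congruent to the sum `S` over
-- integers prime to p.
F : ℕ → ℕ → ℤ
F p e = (1ℤ - ⟨ p /3⟩ * (+ p) ^ e) * U e

-- Removing the multiples of p from the power sums

module _ {q} (pp : Prime (suc q)) (2∤p : 2 ∤ suc q) where
  private
    p = suc q
    χ = ⟨ p /3⟩

  -- The part of T (n * p) e over j prime to p, written j = i p + t + 1 with t < q = p - 1.
  S : ℕ → ℕ → ℤ
  S n e = ∑[ i < n ] ∑[ t < q ] c (i ℕ.* p ℕ.+ suc t) * (+ (i ℕ.* p ℕ.+ suc t)) ^ e

  -- In each block of length p the first term belongs to the multiple j = ip, for which c(ip) (ip)^e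
  -- = (p/3) p^e c(i) i^e.
  T-split : ∀ n e → T (n ℕ.* p) e ≡ χ * (+ p) ^ e * T n e + S n e
  T-split n e = begin
    T (n ℕ.* p) e
      ≡⟨ ∑<-blocks n p f ⟩
    (∑[ i < n ] (f (i ℕ.* p ℕ.+ 0) + (∑[ t < q ] f (i ℕ.* p ℕ.+ suc t))))
      ≡⟨ ∑<-distrib-+ n (λ i → f (i ℕ.* p ℕ.+ 0)) (λ i → ∑[ t < q ] f (i ℕ.* p ℕ.+ suc t)) ⟩
    (∑[ i < n ] f (i ℕ.* p ℕ.+ 0)) + S n e
      ≡⟨ cong (_+ S n e) (∑<-cong n λ i _ → multiple i) ⟩
    (∑[ i < n ] χ * (+ p) ^ e * f i) + S n e
      ≡⟨ cong (_+ S n e) (*-distribˡ-∑< n (χ * (+ p) ^ e) f) ⟨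
    χ * (+ p) ^ e * T n e + S n e ∎
    where
    f : ℕ → ℤ
    f j = c j * (+ j) ^ e
    ring : ∀ x a u v → x * a * (u * v) ≡ x * v * (a * u)
    ring = solve-∀
    multiple : ∀ i → f (i ℕ.* p ℕ.+ 0) ≡ χ * (+ p) ^ e * f i
    multiple i = begin
      f (i ℕ.* p ℕ.+ 0)
        ≡⟨ cong f (ℕ.+-identityʳ (i ℕ.* p)) ⟩
      c (i ℕ.* p) * (+ (i ℕ.* p)) ^ e
        ≡⟨ cong₂ _*_ (c[i*p]≡⟨p/3⟩*c[i] p 2∤p i) (trans (cong (_^ e) (ℤ.pos-* i p)) (^-distrib-* (+ i) (+ p) e)) ⟩
      χ * c i * ((+ i) ^ e * (+ p) ^ e)
        ≡⟨ ring χ (c i) ((+ i) ^ e) ((+ p) ^ e) ⟩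
      χ * (+ p) ^ e * (c i * (+ i) ^ e) ∎

  -- `N∣2U-T` is used at N = 3Kp and at N = 3K; subtracting χ p^e times the second congruence from
  -- the first leaves `S`, by `T-split`. Both N are admissible because K and p are odd, and K
  -- divides both.
  K∣2F-S : ∀ {K} → Odd K → ∀ e → + K ∣ℤ + 2 * F p e - S (K ℕ.* 3) e
  K∣2F-S {K} oddK e = subst (+ K ∣ℤ_) eq
    (ℤ∣.∣m∣n⇒∣m-n (K∣ (K ℕ.* p) (odd-* oddK (2∤⇒odd p 2∤p)) (m∣m*n p))
      (ℤ∣.∣n⇒∣m*n (χ * (+ p) ^ e) (K∣ K oddK ∣-refl)))
    where
    K∣ : ∀ L → Odd L → K ∣ L → + K ∣ℤ + 2 * U e - T (L ℕ.* 3) e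
    K∣ L oddL K∣L = ℤ∣.∣-trans (∣⇒+∣ℤ+ {K} {L ℕ.* 3} (∣m⇒∣m*n 3 K∣L)) (N∣2U-T (c[i*3]≡0 L) (c[1+odd*3]≡-1 oddL) e)
    Kp*3 : ∀ K p → K ℕ.* p ℕ.* 3 ≡ K ℕ.* 3 ℕ.* p
    Kp*3 = ℕ-solve-∀
    ring : ∀ u t s x → + 2 * u - (x * t + s) - x * (+ 2 * u - t) ≡ + 2 * ((1ℤ - x) * u) - s
    ring = solve-∀
    eq : + 2 * U e - T (K ℕ.* p ℕ.* 3) e - χ * (+ p) ^ e * (+ 2 * U e - T (K ℕ.* 3) e)
       ≡ + 2 * F p e - S (K ℕ.* 3) e
    eq = begin
      + 2 * U e - T (K ℕ.* p ℕ.* 3) e - χ * (+ p) ^ e * (+ 2 * U e - T (K ℕ.* 3) e)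
        ≡⟨ cong (λ t → + 2 * U e - t - χ * (+ p) ^ e * (+ 2 * U e - T (K ℕ.* 3) e))
             (trans (cong (λ N → T N e) (Kp*3 K p)) (T-split (K ℕ.* 3) e)) ⟩
      + 2 * U e - (χ * (+ p) ^ e * T (K ℕ.* 3) e + S (K ℕ.* 3) e) - χ * (+ p) ^ e * (+ 2 * U e - T (K ℕ.* 3) e)
        ≡⟨ ring (U e) (T (K ℕ.* 3) e) (S (K ℕ.* 3) e) (χ * (+ p) ^ e) ⟩
      + 2 * F p e - S (K ℕ.* 3) e ∎

  module _ (k m b n : ℕ) where
    private
      -- Here `m` is one less than the positive m of the theorem.
      E = φ (p ℕ.^ suc m)
      P = p ℕ.^ (suc m ℕ.* n)
      e : ℕ → ℕ
      e r = r ℕ.* E ℕ.+ b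
      w : ℕ → ℤ
      w = weight n k

    -- With x = j^E the powers j^(e r) become x^r j^b. By Euler's theorem p^(m+1) divides x - 1, so
    -- P divides (x - 1)^n.
    P∣j-interpolation : ∀ j → p ∤ j →
      + P ∣ℤ c j * (+ j) ^ e k - (∑[ r < n ] w r * (c j * (+ j) ^ e r))
    P∣j-interpolation j p∤j = subst (+ P ∣ℤ_) eq
      (ℤ∣.∣n⇒∣m*n (c j * (+ j) ^ b) (ℤ∣.∣-trans P∣[x-1]^n ([x-1]^n∣interpolation n k x)))
      where
      x = (+ j) ^ E
      P∣[x-1]^n : + P ∣ℤ (x - 1ℤ) ^ n
      P∣[x-1]^n = subst (_∣ℤ (x - 1ℤ) ^ n)
        (trans (pos-^ (p ℕ.^ suc m) n) (cong +_ (ℕ.^-*-assoc p (suc m) n)))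
        (^-mono-∣ n (subst (λ l → + (p ℕ.^ suc m) ∣ℤ (+ j) ^ l - 1ℤ) (sym (φ[p^m] pp m)) (euler-prime-power pp m j p∤j)))
      power : ∀ r → (+ j) ^ e r ≡ x ^ r * (+ j) ^ b
      power r = trans (ℤ.^-distribˡ-+-* (+ j) (r ℕ.* E) b)
        (cong (_* (+ j) ^ b) (trans (cong ((+ j) ^_) (ℕ.*-comm r E)) (sym (ℤ.^-*-assoc (+ j) E r))))
      ring₁ : ∀ a y x s → a * y * (x - s) ≡ a * (x * y) - a * y * s
      ring₁ = solve-∀
      ring₂ : ∀ a y v x → a * y * (v * x) ≡ v * (a * (x * y))
      ring₂ = solve-∀
      eq : c j * (+ j) ^ b * (x ^ k - (∑[ r < n ] w r * x ^ r))
         ≡ c j * (+ j) ^ e k - (∑[ r < n ] w r * (c j * (+ j) ^ e r))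
      eq = begin
        c j * (+ j) ^ b * (x ^ k - (∑[ r < n ] w r * x ^ r))
          ≡⟨ ring₁ (c j) ((+ j) ^ b) (x ^ k) (∑[ r < n ] w r * x ^ r) ⟩
        c j * (x ^ k * (+ j) ^ b) - c j * (+ j) ^ b * (∑[ r < n ] w r * x ^ r)
          ≡⟨ cong₂ (λ u v → c j * u - v) (sym (power k)) (*-distribˡ-∑< n (c j * (+ j) ^ b) (λ r → w r * x ^ r)) ⟩
        c j * (+ j) ^ e k - (∑[ r < n ] c j * (+ j) ^ b * (w r * x ^ r))
          ≡⟨ cong (λ v → c j * (+ j) ^ e k - v) (∑<-cong n λ r _ →
               trans (ring₂ (c j) ((+ j) ^ b) (w r) (x ^ r)) (cong (λ z → w r * (c j * z)) (sym (power r)))) ⟩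
        c j * (+ j) ^ e k - (∑[ r < n ] w r * (c j * (+ j) ^ e r)) ∎

    P∣S-interpolation : ∀ N → + P ∣ℤ S N (e k) - (∑[ r < n ] w r * S N (e r))
    P∣S-interpolation N = ∑<-∣-interchange N n w
      (λ i → ∑[ t < q ] term (e k) i t) (λ r i → ∑[ t < q ] term (e r) i t)
      λ i _ → ∑<-∣-interchange q n w (term (e k) i) (λ r → term (e r) i)
      -- The integer ip + t + 1 is not divisible by p because 0 < t + 1 < p.
      λ t t<q → P∣j-interpolation (i ℕ.* p ℕ.+ suc t) λ p∣j → >⇒∤ (s≤s t<q) (∣m+n∣m⇒∣n p∣j (n∣m*n i))
      where
      term : ℕ → ℕ → ℕ → ℤ
      term e i t = c (i ℕ.* p ℕ.+ suc t) * (+ (i ℕ.* p ℕ.+ suc t)) ^ e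

    -- Modulo P, twice F agrees with `S` at every exponent involved, so the congruence for `S`
    -- carries over, and the 2 cancels because P is odd. The K of `K∣2F-S` is P itself, so that `S`
    -- runs over 3P blocks.
    P∣F-interpolation : + P ∣ℤ F p (e k) - (∑[ r < n ] w r * F p (e r))
    P∣F-interpolation = odd∣2z⇒odd∣z oddP _ (subst (+ P ∣ℤ_) eq
      (ℤ∣.∣m∣n⇒∣m+n
        (ℤ∣.∣m∣n⇒∣m-n (K∣2F-S oddP (e k)) (∑<-∣ n λ r _ → ℤ∣.∣n⇒∣m*n (w r) (K∣2F-S oddP (e r))))
        (P∣S-interpolation (P ℕ.* 3))))
      where
      oddP : Odd P
      oddP = odd-^ (2∤⇒odd p 2∤p) (suc m ℕ.* n)
      s : ℕ → ℤ
      s r = S (P ℕ.* 3) (e r)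
      f : ℕ → ℤ
      f r = F p (e r)
      ring₁ : ∀ f s a b → + 2 * f - s - a + (s - b) ≡ + 2 * f - (a + b)
      ring₁ = solve-∀
      ring₂ : ∀ w f s → w * (+ 2 * f - s) + w * s ≡ + 2 * (w * f)
      ring₂ = solve-∀
      ring₃ : ∀ f z → + 2 * f - + 2 * z ≡ + 2 * (f - z)
      ring₃ = solve-∀
      eq : + 2 * f k - s k - (∑[ r < n ] w r * (+ 2 * f r - s r)) + (s k - (∑[ r < n ] w r * s r))
         ≡ + 2 * (f k - (∑[ r < n ] w r * f r))
      eq = begin
        + 2 * f k - s k - (∑[ r < n ] w r * (+ 2 * f r - s r)) + (s k - (∑[ r < n ] w r * s r))
          ≡⟨ ring₁ (f k) (s k) (∑[ r < n ] w r * (+ 2 * f r - s r)) (∑[ r < n ] w r * s r) ⟩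
        + 2 * f k - ((∑[ r < n ] w r * (+ 2 * f r - s r)) + (∑[ r < n ] w r * s r))
          ≡⟨ cong (λ z → + 2 * f k - z) (∑<-distrib-+ n (λ r → w r * (+ 2 * f r - s r)) (λ r → w r * s r)) ⟨
        + 2 * f k - (∑[ r < n ] (w r * (+ 2 * f r - s r) + w r * s r))
          ≡⟨ cong (λ z → + 2 * f k - z) (∑<-cong n λ r _ → ring₂ (w r) (f r) (s r)) ⟩
        + 2 * f k - (∑[ r < n ] + 2 * (w r * f r))
          ≡⟨ cong (λ z → + 2 * f k - z) (*-distribˡ-∑< n (+ 2) (λ r → w r * f r)) ⟨
        + 2 * f k - + 2 * (∑[ r < n ] w r * f r)
          ≡⟨ ring₃ (f k) (∑[ r < n ] w r * f r) ⟩
        + 2 * (f k - (∑[ r < n ] w r * f r)) ∎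

  -- The case n = 1, whose only weight is 1. The term (p/3) p^e U(e) is added back; p^(m+1) divides
  -- it because e ≥ φ(p^(m+1)) ≥ m + 1 for positive k.
  p^m∣U-F : ∀ k m b → .{{NonZero k}} →
    + (p ℕ.^ suc m) ∣ℤ U (k ℕ.* φ (p ℕ.^ suc m) ℕ.+ b) - F p b
  p^m∣U-F k m b = subst (+ (p ℕ.^ suc m) ∣ℤ_) eq
    (ℤ∣.∣m∣n⇒∣m+n
      (subst (λ l → + (p ℕ.^ l) ∣ℤ F p e - (∑[ r < 1 ] weight 1 k r * F p (r ℕ.* φ (p ℕ.^ suc m) ℕ.+ b)))
        (ℕ.*-identityʳ (suc m)) (P∣F-interpolation k m b 1))
      (ℤ∣.∣m⇒∣m*n (U e) (ℤ∣.∣n⇒∣m*n χ (subst (_∣ℤ (+ p) ^ e) (pos-^ p (suc m)) (i^m∣i^n (+ p) 1+m≤e)))))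
    where
    e = k ℕ.* φ (p ℕ.^ suc m) ℕ.+ b
    1+m≤e : suc m ≤ e
    1+m≤e = ℕ.≤-trans (m≤φ[p^m] pp (suc m)) (ℕ.≤-trans (ℕ.m≤n*m (φ (p ℕ.^ suc m)) k) (ℕ.m≤m+n _ b))
    ring : ∀ x u f → (1ℤ - x) * u - (1ℤ * f + 0ℤ) + x * u ≡ u - f
    ring = solve-∀
    eq : F p e - (weight 1 k 0 * F p b + 0ℤ) + χ * (+ p) ^ e * U e ≡ U e - F p b
    eq = begin
      F p e - (weight 1 k 0 * F p b + 0ℤ) + χ * (+ p) ^ e * U e
        ≡⟨ cong (λ z → F p e - (z * F p b + 0ℤ) + χ * (+ p) ^ e * U e) (trans (weight-last 0 k) (cong +_ (nC0≡1 k))) ⟩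
      F p e - (1ℤ * F p b + 0ℤ) + χ * (+ p) ^ e * U e
        ≡⟨ ring (χ * (+ p) ^ e) (U e) (F p b) ⟩
      U e - F p b ∎

theorem4p3 : (p : ℕ) → Prime p → ¬ (2 ∣ p) →
    (k m b : ℕ) → .{{NonZero k}} → .{{NonZero m}} → 2 ∣ b →
    ((n : ℕ) → .{{NonZero n}} →
      (1ℤ - ⟨ p /3⟩ * (+ p) ^ (k ℕ.* φ (p ℕ.^ m) ℕ.+ b)) * U (k ℕ.* φ (p ℕ.^ m) ℕ.+ b)
        ≡ ∑[ r < n ]
            -1ℤ ^ (n ∸ 1 ∸ r) * binom (+ k - 1ℤ - + r) (n ∸ 1 ∸ r) * + (k C r)
              * ((1ℤ - ⟨ p /3⟩ * (+ p) ^ (r ℕ.* φ (p ℕ.^ m) ℕ.+ b)) * U (r ℕ.* φ (p ℕ.^ m) ℕ.+ b))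
        [mod p ℕ.^ (m ℕ.* n) ])
    × (U (k ℕ.* φ (p ℕ.^ m) ℕ.+ b) ≡ (1ℤ - ⟨ p /3⟩ * (+ p) ^ b) * U b [mod p ℕ.^ m ])
theorem4p3 zero    pp _ _ _ _ _ = contradiction pp ¬prime[0]
theorem4p3 (suc q) pp 2∤p k (suc m) b _ =
    -- `F` and `weight` unfold to the expressions of the statement, so that only the passage from
    -- signed divisibility to divisibility of absolute values remains.
    (λ n → ℤ∣.∣⇒∣ᵤ (P∣F-interpolation pp 2∤p k m b n))
  , ℤ∣.∣⇒∣ᵤ (p^m∣U-F pp 2∤p k m b)
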